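{- Let $q$ be a prime power with $q\equiv 3 \pmod 8$. Then there exists a symmetric Hadamard matrix of order $q(1+q)$.
   Context: A Hadamard matrix of order $m$ is an $m\times m$ matrix $H$ with entries in $\{+1,-1\}$ such that $HH^T=mI_m$, where $I_m$ is the identity matrix. It is symmetric if $H^T=H$. -}

module Defs where

open import Data.Nat using (ℕ; zero; suc; _^_; _≥_; _%_)
open import Data.Nat.Primality using (Prime)
open import Data.Integer using (ℤ; +_; -[1+_]; _+_; _*_)
open import Data.Fin using (Fin; zero; suc)
open import Data.Product using (Σ; ∃; _×_; ∃-syntax)
open import Data.Sum using (_⊎_)
open import Relation.Binary.PropositionalEquality using (_≡_)
open import Relation.Nullary using (¬_; yes; no)
import Data.Fin

Matrix : ℕ → Set
Matrix m = Fin m → Fin m → ℤ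

∑ : ∀ {n} → (Fin n → ℤ) → ℤ
∑ {zero} f = + 0
∑ {suc n} f = f zero + ∑ (λ i → f (suc i))

IsPM1 : ℤ → Set
IsPM1 x = x ≡ + 1 ⊎ x ≡ -[1+ 0 ]

δ : ∀ {m} → Fin m → Fin m → ℤ
δ i j with i Data.Fin.≟ j
... | yes _ = + 1
... | no _ = + 0

IsHadamard : (m : ℕ) → Matrix m → Set
IsHadamard m H =
  (∀ i j → IsPM1 (H i j)) ×
  (∀ i j → ∑ (λ k → H i k * H j k) ≡ (+ m) * δ i j)

IsSymmetric : (m : ℕ) → Matrix m → Set
IsSymmetric m H = ∀ i j → H i j ≡ H j i

IsPrimePower : ℕ → Set
IsPrimePower q = ∃[ p ] ∃[ k ] (Prime p × k ≥ 1 × q ≡ p ^ k)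

{-# OPTIONS --safe #-}
module Submission where

-- Let Q be a skew core of order q (zero diagonal, ±1 elsewhere, QQᵀ = qI − J, QJ = 0) and R a symmetric
-- permutation matrix with S = QR symmetric.  With C = ((0 , 1) , (−1 , Q)) the skew conference matrix of
-- order 1 + q, Williamson's matrix J ⊗ I + (Q + I) ⊗ C is Hadamard of order q(1 + q), the cross terms
-- cancelling because C is skew.  Multiplying on the right by the signed permutation R ⊗ P, where
-- P = diag(−1 , R), makes it symmetric: it becomes J ⊗ P + (S + R) ⊗ CP.
--
-- For a prime p ≡ 3 (mod 4) such a pair is given by the Legendre symbol χ and R the reversal of indices.
-- As q ≡ 3 (mod 8) forces q = p^k with k odd and p ≡ 3 (mod 4), the field of order q can be avoided:
-- Turyn's construction makes a core of order p^k out of one of order p, as the sum of the cyclic Kronecker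
-- words of length k in the letter S and the pair of letters R J.

open import Defs
open import Algebra.Bundles using (CommutativeMonoid)
import Algebra.Properties.CommutativeMonoid.Sum as Sum
open import Data.Bool using (Bool; true; false; not)
open import Data.Fin using (Fin; zero; suc; toℕ; fromℕ<; opposite; punchIn; punchOut; _↑ˡ_; _↑ʳ_; combine; quotient; remainder)
import Data.Fin as Fin
import Data.Fin.Properties as Fin
open import Data.Integer using (ℤ; +_; _+_; _*_; _-_; -_; _^_; ∣_∣; _%ℕ_; _/ℕ_)
open import Data.Integer.DivMod using (n%ℕd<d; a≡a%ℕn+[a/ℕn]*n)
open import Data.Integer.Divisibility.Signed
  using (_∣_; divides; ∣ᵤ⇒∣; ∣⇒∣ᵤ; ∣m∣n⇒∣m+n; ∣m⇒∣-m; ∣m⇒∣m*n; ∣n⇒∣m*n; _∣?_)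
import Data.Integer.Properties as ℤ
open import Data.Integer.Tactic.RingSolver using (solve-∀)
open import Data.Nat as ℕ using (ℕ; zero; suc; _/_; _%_)
import Data.Nat.Divisibility as ℕ
open import Data.Nat.DivMod using (m%n<n; m≡m%n+[m/n]*n; m%n%n≡m%n; m∣n⇒o%n%m≡o%m; %-distribˡ-*)
open import Data.Nat.Primality using (Prime; euclidsLemma)
import Data.Nat.Properties as ℕ
import Data.Nat.Tactic.RingSolver as ℕ-Solver
open import Data.Product using (_×_; _,_; proj₁; proj₂; ∃-syntax)
open import Data.Sum using (_⊎_; inj₁; inj₂)
open import Function using (_∘_)
open import Relation.Nullary using (Dec; yes; no; contradiction; ¬_)
open import Relation.Binary.PropositionalEquality
  using (_≡_; _≢_; refl; sym; trans; cong; cong₂; subst; subst₂; module ≡-Reasoning)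
open ≡-Reasoning

private variable
  m n : ℕ

+-congˡ : ∀ a {b c} → b ≡ c → a + b ≡ a + c
+-congˡ a = cong (λ b → a + b)

∑-cong : {f g : Fin n → ℤ} → (∀ i → f i ≡ g i) → ∑ f ≡ ∑ g
∑-cong {zero}  f≗g = refl
∑-cong {suc n} f≗g = cong₂ _+_ (f≗g zero) (∑-cong (f≗g ∘ suc))

∑-+ : (f g : Fin n → ℤ) → ∑ (λ i → f i + g i) ≡ ∑ f + ∑ g
∑-+ {zero}  f g = refl
∑-+ {suc n} f g = trans (+-congˡ (f zero + g zero) (∑-+ (f ∘ suc) (g ∘ suc))) (lemma (f zero) (g zero) _ _)
  where
  lemma : ∀ a b c d → (a + b) + (c + d) ≡ (a + c) + (b + d)
  lemma = solve-∀

∑-*ˡ : (c : ℤ) (f : Fin n → ℤ) → ∑ (λ i → c * f i) ≡ c * ∑ f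
∑-*ˡ {zero}  c f = sym (ℤ.*-zeroʳ c)
∑-*ˡ {suc n} c f = trans (+-congˡ (c * f zero) (∑-*ˡ c (f ∘ suc))) (sym (ℤ.*-distribˡ-+ c (f zero) _))

∑-*ʳ : (f : Fin n → ℤ) (c : ℤ) → ∑ (λ i → f i * c) ≡ ∑ f * c
∑-*ʳ f c = trans (∑-cong (λ i → ℤ.*-comm (f i) c)) (trans (∑-*ˡ c f) (ℤ.*-comm c _))

∑-zero : (f : Fin n → ℤ) → (∀ i → f i ≡ + 0) → ∑ f ≡ + 0
∑-zero {zero}  f f≗0 = refl
∑-zero {suc n} f f≗0 = cong₂ _+_ (f≗0 zero) (∑-zero (f ∘ suc) (f≗0 ∘ suc))

∑-one : ∀ n → ∑ {n} (λ _ → + 1) ≡ + n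
∑-one zero    = refl
∑-one (suc n) = +-congˡ (+ 1) (∑-one n)

∑-++ : ∀ m {n} (f : Fin (m ℕ.+ n) → ℤ) → ∑ f ≡ ∑ (λ i → f (i ↑ˡ n)) + ∑ (λ j → f (m ↑ʳ j))
∑-++ zero    f = sym (ℤ.+-identityˡ _)
∑-++ (suc m) f = trans (+-congˡ (f zero) (∑-++ m (f ∘ suc))) (sym (ℤ.+-assoc (f zero) _ _))

∑-combine : ∀ m {n} (f : Fin (m ℕ.* n) → ℤ) → ∑ f ≡ ∑ λ i → ∑ λ j → f (combine {m} i j)
∑-combine zero        f = refl
∑-combine (suc m) {n} f = trans (∑-++ n f) (+-congˡ (∑ λ j → f (combine {suc m} zero j)) (∑-combine m (λ x → f (n ↑ʳ x))))

δ-refl : (i : Fin n) → δ i i ≡ + 1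
δ-refl i with i Fin.≟ i
... | yes _  = refl
... | no i≢i = contradiction refl i≢i

δ-≢ : {i j : Fin n} → i ≢ j → δ i j ≡ + 0
δ-≢ {i = i} {j} i≢j with i Fin.≟ j
... | yes i≡j = contradiction i≡j i≢j
... | no _    = refl

δ-suc : (i j : Fin n) → δ (suc i) (suc j) ≡ δ i j
δ-suc i j = by-cases (i Fin.≟ j)
  where
  by-cases : Dec (i ≡ j) → δ (suc i) (suc j) ≡ δ i j
  by-cases (yes refl) = trans (δ-refl (suc i)) (sym (δ-refl i))
  by-cases (no i≢j)   = trans (δ-≢ (i≢j ∘ Fin.suc-injective)) (sym (δ-≢ i≢j))

∑-δ : (f : Fin n → ℤ) (i : Fin n) → ∑ (λ k → f k * δ i k) ≡ f i
∑-δ f zero = begin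
  f zero * + 1 + ∑ (λ k → f (suc k) * + 0) ≡⟨ cong₂ _+_ (ℤ.*-identityʳ (f zero)) (∑-zero _ (λ k → ℤ.*-zeroʳ (f (suc k)))) ⟩
  f zero + + 0                             ≡⟨ ℤ.+-identityʳ (f zero) ⟩
  f zero                                   ∎
∑-δ f (suc i) = begin
  f zero * + 0 + ∑ (λ k → f (suc k) * δ (suc i) (suc k)) ≡⟨ cong₂ _+_ (ℤ.*-zeroʳ (f zero)) (∑-cong λ k → cong (f (suc k) *_) (δ-suc i k)) ⟩
  + 0 + ∑ (λ k → f (suc k) * δ i k)                      ≡⟨ ℤ.+-identityˡ _ ⟩
  ∑ (λ k → f (suc k) * δ i k)                            ≡⟨ ∑-δ (f ∘ suc) i ⟩
  f (suc i)                                              ∎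

infixl 6 _⊕_
infixl 7 _⊗_

_⊕_ : Matrix n → Matrix n → Matrix n
(A ⊕ B) x y = A x y + B x y

_⊗_ : Matrix m → Matrix n → Matrix (m ℕ.* n)
_⊗_ {m} {n} A B x y =
  A (quotient n x) (quotient n y) * B (remainder {m} n x) (remainder {m} n y)

J : Matrix n
J _ _ = + 1

gram : Matrix n → Matrix n → Matrix n
gram A B x y = ∑ λ k → A x k * B y k

⊗-combine : (A : Matrix m) (B : Matrix n) (x : Fin (m ℕ.* n)) (k : Fin m) (l : Fin n) →
  (A ⊗ B) x (combine k l) ≡ A (quotient n x) k * B (remainder {m} n x) l
⊗-combine {m} {n} A B x k l =
  cong (λ kl → A (quotient n x) (proj₁ kl) * B (remainder {m} n x) (proj₂ kl)) (Fin.remQuot-combine k l)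

∑-⊗ : (A : Matrix m) (B : Matrix n) (x : Fin (m ℕ.* n)) →
  ∑ ((A ⊗ B) x) ≡ ∑ (A (quotient n x)) * ∑ (B (remainder {m} n x))
∑-⊗ {m} {n} A B x = begin
  ∑ ((A ⊗ B) x)                               ≡⟨ ∑-combine m _ ⟩
  (∑ λ k → ∑ λ l → (A ⊗ B) x (combine {m} k l)) ≡⟨ ∑-cong (λ k → ∑-cong (⊗-combine A B x k)) ⟩
  (∑ λ k → ∑ λ l → A _ k * B _ l)              ≡⟨ ∑-cong (λ k → ∑-*ˡ (A _ k) (B _)) ⟩
  (∑ λ k → A _ k * ∑ (B _))                    ≡⟨ ∑-*ʳ (A _) _ ⟩
  ∑ (A _) * ∑ (B _)                            ∎

gram-⊗ : (A A′ : Matrix m) (B B′ : Matrix n) → ∀ x y →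
  gram (A ⊗ B) (A′ ⊗ B′) x y ≡ (gram A A′ ⊗ gram B B′) x y
gram-⊗ {m} {n} A A′ B B′ x y = begin
  gram (A ⊗ B) (A′ ⊗ B′) x y
    ≡⟨ ∑-combine m _ ⟩
  (∑ λ k → ∑ λ l → (A ⊗ B) x (combine {m} k l) * (A′ ⊗ B′) y (combine {m} k l))
    ≡⟨ ∑-cong (λ k → ∑-cong λ l → trans (cong₂ _*_ (⊗-combine A B x k l) (⊗-combine A′ B′ y k l)) (swap (A _ k) (B _ l) (A′ _ k) (B′ _ l))) ⟩
  (∑ λ k → ∑ λ l → A _ k * A′ _ k * (B _ l * B′ _ l))
    ≡⟨ ∑-cong (λ k → ∑-*ˡ (A _ k * A′ _ k) (λ l → B _ l * B′ _ l)) ⟩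
  (∑ λ k → A _ k * A′ _ k * gram B B′ _ _)
    ≡⟨ ∑-*ʳ (λ k → A _ k * A′ _ k) _ ⟩
  (gram A A′ ⊗ gram B B′) x y ∎
  where
  swap : ∀ a b c d → a * b * (c * d) ≡ a * c * (b * d)
  swap = solve-∀

gram-⊕ : (A B C D : Matrix n) → ∀ x y →
  gram (A ⊕ B) (C ⊕ D) x y ≡ gram A C x y + gram A D x y + gram B C x y + gram B D x y
gram-⊕ A B C D x y = begin
  gram (A ⊕ B) (C ⊕ D) x y
    ≡⟨ ∑-cong (λ k → expand (A x k) (B x k) (C y k) (D y k)) ⟩
  (∑ λ k → A x k * C y k + A x k * D y k + B x k * C y k + B x k * D y k)
    ≡⟨ ∑-+ _ (λ k → B x k * D y k) ⟩
  (∑ λ k → A x k * C y k + A x k * D y k + B x k * C y k) + gram B D x y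
    ≡⟨ cong (_+ gram B D x y) (trans (∑-+ _ (λ k → B x k * C y k)) (cong (_+ gram B C x y) (∑-+ (λ k → A x k * C y k) _))) ⟩
  gram A C x y + gram A D x y + gram B C x y + gram B D x y ∎
  where
  expand : ∀ a b c d → (a + b) * (c + d) ≡ a * c + a * d + b * c + b * d
  expand = solve-∀

gram-⊕⊗ : (A C : Matrix m) (B D : Matrix n) (A′ C′ : Matrix m) (B′ D′ : Matrix n) → ∀ x y →
  gram (A ⊗ B ⊕ C ⊗ D) (A′ ⊗ B′ ⊕ C′ ⊗ D′) x y ≡
    (gram A A′ ⊗ gram B B′) x y + (gram A C′ ⊗ gram B D′) x y
    + (gram C A′ ⊗ gram D B′) x y + (gram C C′ ⊗ gram D D′) x y
gram-⊕⊗ A C B D A′ C′ B′ D′ x y = trans (gram-⊕ (A ⊗ B) (C ⊗ D) (A′ ⊗ B′) (C′ ⊗ D′) x y)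
  (cong₂ _+_ (cong₂ _+_ (cong₂ _+_ (gram-⊗ A A′ B B′ x y) (gram-⊗ A C′ B D′ x y))
    (gram-⊗ C A′ D B′ x y)) (gram-⊗ C C′ D D′ x y))

gram-⊕⊗ˡ : (A C : Matrix m) (B D : Matrix n) (A′ : Matrix m) (B′ : Matrix n) → ∀ x y →
  gram (A ⊗ B ⊕ C ⊗ D) (A′ ⊗ B′) x y ≡ (gram A A′ ⊗ gram B B′) x y + (gram C A′ ⊗ gram D B′) x y
gram-⊕⊗ˡ A C B D A′ B′ x y = begin
  gram (A ⊗ B ⊕ C ⊗ D) (A′ ⊗ B′) x y
    ≡⟨ ∑-cong (λ k → ℤ.*-distribʳ-+ ((A′ ⊗ B′) y k) ((A ⊗ B) x k) _) ⟩
  (∑ λ k → (A ⊗ B) x k * (A′ ⊗ B′) y k + (C ⊗ D) x k * (A′ ⊗ B′) y k)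
    ≡⟨ ∑-+ (λ k → (A ⊗ B) x k * (A′ ⊗ B′) y k) _ ⟩
  gram (A ⊗ B) (A′ ⊗ B′) x y + gram (C ⊗ D) (A′ ⊗ B′) x y
    ≡⟨ cong₂ _+_ (gram-⊗ A A′ B B′ x y) (gram-⊗ C A′ D B′ x y) ⟩
  (gram A A′ ⊗ gram B B′) x y + (gram C A′ ⊗ gram D B′) x y ∎

gram-swap : (A B : Matrix n) → ∀ x y → gram A B x y ≡ gram B A y x
gram-swap A B x y = ∑-cong (λ k → ℤ.*-comm (A x k) (B y k))

gram-Jˡ : (A : Matrix n) → ∀ x y → gram J A x y ≡ ∑ (A y)
gram-Jˡ A x y = ∑-cong (λ k → ℤ.*-identityˡ (A y k))

gram-Jʳ : (A : Matrix n) → ∀ x y → gram A J x y ≡ ∑ (A x)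
gram-Jʳ A x y = ∑-cong (λ k → ℤ.*-identityʳ (A x k))

gram-JJ : ∀ {n} (x y : Fin n) → gram J J x y ≡ + n
gram-JJ {n} x y = ∑-one n

δ-⊗ : ∀ m {n} (x y : Fin (m ℕ.* n)) → δ x y ≡ (_⊗_ {m} δ δ) x y
δ-⊗ m {n} x y with quotient {m} n x Fin.≟ quotient n y | remainder {m} n x Fin.≟ remainder {m} n y
... | yes p | yes r = trans (cong (δ x) (sym x≡y)) (δ-refl x)
  where
  x≡y : x ≡ y
  x≡y = trans (sym (Fin.combine-remQuot {m} n x)) (trans (cong₂ combine p r) (Fin.combine-remQuot {m} n y))
... | no ¬p | _     = δ-≢ (¬p ∘ cong (quotient {m} n))
... | yes _ | no ¬r = δ-≢ (¬r ∘ cong (remainder {m} n))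

IsPM1-* : ∀ {a b} → IsPM1 a → IsPM1 b → IsPM1 (a * b)
IsPM1-* (inj₁ refl) (inj₁ refl) = inj₁ refl
IsPM1-* (inj₁ refl) (inj₂ refl) = inj₂ refl
IsPM1-* (inj₂ refl) (inj₁ refl) = inj₂ refl
IsPM1-* (inj₂ refl) (inj₂ refl) = inj₁ refl

Letter : ℤ → ℤ → Set
Letter s ρ = (ρ ≡ + 1 × s ≡ + 0) ⊎ (ρ ≡ + 0 × IsPM1 s)

-- R is a permutation matrix and Q = SR a skew core (Q Qᵀ = nI − J, Qᵀ = −Q).
record Core {n : ℕ} (S R : Matrix n) : Set where
  field
    S-sym   : IsSymmetric n S
    R-sym   : IsSymmetric n R
    SS      : ∀ x y → gram S S x y ≡ + n * δ x y - + 1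
    RR      : ∀ x y → gram R R x y ≡ δ x y
    SR      : ∀ x y → gram S R x y ≡ - gram R S x y
    S-row   : ∀ x → ∑ (S x) ≡ + 0
    R-row   : ∀ x → ∑ (R x) ≡ + 1
    entries : ∀ x y → Letter (S x y) (R x y)

  gram-SJ : ∀ x y → gram S J x y ≡ + 0
  gram-SJ x y = trans (gram-Jʳ S x y) (S-row x)

  gram-JS : ∀ x y → gram J S x y ≡ + 0
  gram-JS x y = trans (gram-Jˡ S x y) (S-row y)

  gram-RJ : ∀ x y → gram R J x y ≡ + 1
  gram-RJ x y = trans (gram-Jʳ R x y) (R-row x)

  gram-JR : ∀ x y → gram J R x y ≡ + 1
  gram-JR x y = trans (gram-Jˡ R x y) (R-row y)

module Hadamard {q : ℕ} {S R : Matrix q} (core : Core S R) where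
  open Core core

  W : Matrix q
  W = S ⊕ R

  P T : Matrix (1 ℕ.+ q)
  P zero    zero    = - + 1
  P zero    (suc y) = + 0
  P (suc x) zero    = + 0
  P (suc x) (suc y) = R x y
  T zero    zero    = + 0
  T zero    (suc y) = + 1
  T (suc x) zero    = + 1
  T (suc x) (suc y) = S x y

  H : Matrix (q ℕ.* (1 ℕ.+ q))
  H = J {q} ⊗ P ⊕ W ⊗ T

  P-sym : IsSymmetric _ P
  P-sym zero    zero    = refl
  P-sym zero    (suc y) = refl
  P-sym (suc x) zero    = refl
  P-sym (suc x) (suc y) = R-sym x y

  T-sym : IsSymmetric _ T
  T-sym zero    zero    = refl
  T-sym zero    (suc y) = refl
  T-sym (suc x) zero    = refl
  T-sym (suc x) (suc y) = S-sym x y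

  H-sym : IsSymmetric _ H
  H-sym x y = cong₂ _+_ (cong (+ 1 *_) (P-sym a b)) (cong₂ _*_ (cong₂ _+_ (S-sym i j) (R-sym i j)) (T-sym a b))
    where
    i = quotient {q} (1 ℕ.+ q) x
    j = quotient {q} (1 ℕ.+ q) y
    a = remainder {q} (1 ℕ.+ q) x
    b = remainder {q} (1 ℕ.+ q) y

  W-pm1 : ∀ x y → IsPM1 (W x y)
  W-pm1 x y with entries x y
  ... | inj₁ (r , s)      = inj₁ (cong₂ _+_ s r)
  ... | inj₂ (r , inj₁ s) = inj₁ (cong₂ _+_ s r)
  ... | inj₂ (r , inj₂ s) = inj₂ (cong₂ _+_ s r)

  PT-entries : ∀ x y → (IsPM1 (P x y) × T x y ≡ + 0) ⊎ (P x y ≡ + 0 × IsPM1 (T x y))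
  PT-entries zero    zero    = inj₁ (inj₂ refl , refl)
  PT-entries zero    (suc y) = inj₂ (refl , inj₁ refl)
  PT-entries (suc x) zero    = inj₂ (refl , inj₁ refl)
  PT-entries (suc x) (suc y) with entries x y
  ... | inj₁ (r , s) = inj₁ (inj₁ r , s)
  ... | inj₂ (r , s) = inj₂ (r , s)

  H-pm1 : ∀ x y → IsPM1 (H x y)
  H-pm1 x y = pm1 (W-pm1 (quotient {q} (1 ℕ.+ q) x) (quotient (1 ℕ.+ q) y))
    (PT-entries (remainder {q} (1 ℕ.+ q) x) (remainder {q} (1 ℕ.+ q) y))
    where
    pm1 : ∀ {w p t} → IsPM1 w → (IsPM1 p × t ≡ + 0) ⊎ (p ≡ + 0 × IsPM1 t) → IsPM1 (+ 1 * p + w * t)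
    pm1 {w} {p} pm-w (inj₁ (pm-p , refl)) = subst IsPM1 (lemma w p) pm-p
      where
      lemma : ∀ w p → p ≡ + 1 * p + w * + 0
      lemma = solve-∀
    pm1 {w} {t = t} pm-w (inj₂ (refl , pm-t)) = subst IsPM1 (sym (ℤ.+-identityˡ (w * t))) (IsPM1-* pm-w pm-t)

  gram-WW : ∀ x y → gram W W x y ≡ (+ 1 + + q) * δ x y - + 1
  gram-WW x y = begin
    gram W W x y
      ≡⟨ gram-⊕ S R S R x y ⟩
    gram S S x y + gram S R x y + gram R S x y + gram R R x y
      ≡⟨ cong₂ _+_ (cong₂ _+_ (cong₂ _+_ (SS x y) (SR x y)) refl) (RR x y) ⟩
    + q * δ x y - + 1 + - gram R S x y + gram R S x y + δ x y
      ≡⟨ lemma (+ q) (δ x y) (gram R S x y) ⟩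
    (+ 1 + + q) * δ x y - + 1 ∎
    where
    lemma : ∀ q d z → q * d - + 1 + - z + z + d ≡ (+ 1 + q) * d - + 1
    lemma = solve-∀

  W-row : ∀ x → ∑ (W x) ≡ + 1
  W-row x = trans (∑-+ (S x) (R x)) (cong₂ _+_ (S-row x) (R-row x))

  gram-PP : ∀ x y → gram P P x y ≡ δ x y
  gram-PP zero    zero    = +-congˡ (+ 1) (∑-zero {q} _ (λ _ → refl))
  gram-PP zero    (suc y) = trans (ℤ.+-identityˡ _) (∑-zero {q} _ (λ _ → refl))
  gram-PP (suc x) zero    = trans (ℤ.+-identityˡ _) (∑-zero _ (λ k → ℤ.*-zeroʳ (R x k)))
  gram-PP (suc x) (suc y) = trans (ℤ.+-identityˡ _) (trans (RR x y) (sym (δ-suc x y)))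

  gram-TT : ∀ x y → gram T T x y ≡ + q * δ x y
  gram-TT zero    zero    = trans (ℤ.+-identityˡ _) (trans (∑-one q) (sym (ℤ.*-identityʳ (+ q))))
  gram-TT zero    (suc y) = trans (ℤ.+-identityˡ _) (trans (gram-JS y y) (sym (ℤ.*-zeroʳ (+ q))))
  gram-TT (suc x) zero    = trans (ℤ.+-identityˡ _) (trans (gram-SJ x x) (sym (ℤ.*-zeroʳ (+ q))))
  gram-TT (suc x) (suc y) = begin
    + 1 + gram S S x y        ≡⟨ +-congˡ (+ 1) (SS x y) ⟩
    + 1 + (+ q * δ x y - + 1) ≡⟨ lemma (+ q * δ x y) ⟩
    + q * δ x y               ≡⟨ cong (+ q *_) (δ-suc x y) ⟨
    + q * δ (suc x) (suc y)   ∎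
    where
    lemma : ∀ z → + 1 + (z - + 1) ≡ z
    lemma = solve-∀

  gram-TP : ∀ x y → gram T P x y ≡ - gram P T x y
  gram-TP zero    zero    = trans (+-congˡ (+ 0) (∑-zero {q} _ (λ _ → refl))) (cong -_ (+-congˡ (+ 0) (sym (∑-zero {q} _ λ _ → refl))))
  gram-TP zero    (suc y) = trans (+-congˡ (+ 0) (gram-JR y y)) (cong -_ (+-congˡ (- + 1) (sym (∑-zero {q} _ λ _ → refl))))
  gram-TP (suc x) zero    = trans (+-congˡ (- + 1) (∑-zero _ (λ k → ℤ.*-zeroʳ (S x k)))) (cong -_ (+-congˡ (+ 0) (sym (gram-RJ x x))))
  gram-TP (suc x) (suc y) = trans (ℤ.+-identityˡ _) (trans (SR x y) (cong -_ (sym (ℤ.+-identityˡ _))))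

  gram-HH : ∀ x y → gram H H x y ≡ + (q ℕ.* (1 ℕ.+ q)) * δ x y
  gram-HH x y = begin
    gram H H x y
      ≡⟨ gram-⊕⊗ (J {q}) W P T J W P T x y ⟩
    gram J J i j * gram P P a b + gram J W i j * gram P T a b + gram W J i j * gram T P a b + gram W W i j * gram T T a b
      ≡⟨ cong₂ _+_ (cong₂ _+_ (cong₂ _+_
           (cong₂ _*_ (gram-JJ i j) (gram-PP a b))
           (cong (_* gram P T a b) (trans (gram-Jˡ W i j) (W-row j))))
           (cong₂ _*_ (trans (gram-Jʳ W i j) (W-row i)) (gram-TP a b)))
           (cong₂ _*_ (gram-WW i j) (gram-TT a b)) ⟩
    + q * δ a b + + 1 * gram P T a b + + 1 * (- gram P T a b) + ((+ 1 + + q) * δ i j - + 1) * (+ q * δ a b)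
      ≡⟨ lemma (+ q) (δ a b) (gram P T a b) (δ i j) ⟩
    + q * (+ 1 + + q) * (δ i j * δ a b)
      ≡⟨ cong₂ _*_ (ℤ.pos-* q (1 ℕ.+ q)) (δ-⊗ q x y) ⟨
    + (q ℕ.* (1 ℕ.+ q)) * δ x y ∎
    where
    i = quotient {q} (1 ℕ.+ q) x
    j = quotient {q} (1 ℕ.+ q) y
    a = remainder {q} (1 ℕ.+ q) x
    b = remainder {q} (1 ℕ.+ q) y

    lemma : ∀ q d z e → q * d + + 1 * z + + 1 * (- z) + ((+ 1 + q) * e - + 1) * (q * d) ≡ q * (+ 1 + q) * (e * d)
    lemma = solve-∀

-- Odd Kronecker powers of cores

data Odd : ℕ → Set where
  one : Odd 1
  2+_ : ∀ {r} → Odd r → Odd (suc (suc r))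

data Shape : Bool → (a b c d ρ : ℤ) → Set where
  equal-even : Shape false (+ 1) (+ 0) (+ 0) (+ 1) (+ 1)
  equal-odd  : Shape true (+ 0) (+ 1) (+ 1) (+ 0) (+ 1)
  left       : ∀ {o a c} → IsPM1 a → IsPM1 c → Shape o a (+ 0) c (+ 0) (+ 0)
  right      : ∀ {o b d} → IsPM1 b → IsPM1 d → Shape o (+ 0) b (+ 0) d (+ 0)

shape-step : ∀ {s ρ₁ o a b c d ρ} → Letter s ρ₁ → Shape o a b c d ρ →
  Shape (not o) (s * a + ρ₁ * c) (s * b + ρ₁ * d) (+ 1 * a) (+ 1 * b) (ρ₁ * ρ)
shape-step (inj₁ (refl , refl)) equal-even = equal-odd
shape-step (inj₁ (refl , refl)) equal-odd  = equal-even
shape-step (inj₁ (refl , refl)) (left {a = a} {c} pa pc) =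
  left (subst IsPM1 (lemma a c) pc) (subst IsPM1 (sym (ℤ.*-identityˡ a)) pa)
  where
  lemma : ∀ a c → c ≡ + 0 * a + + 1 * c
  lemma = solve-∀
shape-step (inj₁ (refl , refl)) (right {b = b} {d} pb pd) =
  right (subst IsPM1 (lemma b d) pd) (subst IsPM1 (sym (ℤ.*-identityˡ b)) pb)
  where
  lemma : ∀ b d → d ≡ + 0 * b + + 1 * d
  lemma = solve-∀
shape-step (inj₂ (refl , inj₁ refl)) equal-even = left (inj₁ refl) (inj₁ refl)
shape-step (inj₂ (refl , inj₂ refl)) equal-even = left (inj₂ refl) (inj₁ refl)
shape-step (inj₂ (refl , inj₁ refl)) equal-odd  = right (inj₁ refl) (inj₁ refl)
shape-step (inj₂ (refl , inj₂ refl)) equal-odd  = right (inj₂ refl) (inj₁ refl)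
shape-step {s} (inj₂ (refl , ps)) (left {a = a} {c} pa pc)
  rewrite ℤ.*-zeroʳ s =
  left (subst IsPM1 (sym (ℤ.+-identityʳ (s * a))) (IsPM1-* ps pa)) (subst IsPM1 (sym (ℤ.*-identityˡ a)) pa)
shape-step {s} (inj₂ (refl , ps)) (right {b = b} {d} pb pd)
  rewrite ℤ.*-zeroʳ s =
  right (subst IsPM1 (sym (ℤ.+-identityʳ (s * b))) (IsPM1-* ps pb)) (subst IsPM1 (sym (ℤ.*-identityˡ b)) pb)

alternate : ℤ → ℤ → ℕ → ℤ
alternate x y zero    = x
alternate x y (suc r) = alternate y x r

sign : ℤ → ℕ → ℤ
sign s zero    = s
sign s (suc r) = - sign s r

sign-odd : ∀ s {r} → Odd r → sign s r ≡ - s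
sign-odd s one    = refl
sign-odd s (2+ o) = trans (ℤ.neg-involutive _) (sign-odd s o)

alternate-odd : ∀ x y {r} → Odd r → alternate x y r ≡ y
alternate-odd x y one    = refl
alternate-odd x y (2+ o) = alternate-odd x y o

alternate-same : ∀ x r → alternate x x r ≡ x
alternate-same x zero    = refl
alternate-same x (suc r) = alternate-same x r

odd? : ℕ → Bool
odd? zero    = false
odd? (suc r) = not (odd? r)

odd?-odd : ∀ {r} → Odd r → odd? r ≡ true
odd?-odd one    = refl
odd?-odd (2+ o) rewrite odd?-odd o = refl

module Power {p : ℕ} {S R : Matrix p} (core : Core S R) where
  open Core core

  -- U and W are the sums of the Kronecker words of length r read from state 0, resp. 1, of the automaton
  -- with transitions 0 –S→ 0, 0 –R→ 1, 1 –J→ 0; a word ending in state 0, resp. 1, is weighted by a, resp. c.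
  U W : ℤ → ℤ → ∀ r → Matrix (p ℕ.^ r)
  U a c zero    _ _ = a
  U a c (suc r)     = S ⊗ U a c r ⊕ R ⊗ W a c r
  W a c zero    _ _ = c
  W a c (suc r)     = J {p} ⊗ U a c r

  Rᵖ : ∀ r → Matrix (p ℕ.^ r)
  Rᵖ zero    _ _ = + 1
  Rᵖ (suc r)     = R ⊗ Rᵖ r

  -- Closed words only.
  Sᵖ : ∀ r → Matrix (p ℕ.^ r)
  Sᵖ r = U (+ 1) (+ 0) r ⊕ W (+ 0) (+ 1) r

  head : ∀ r → Fin (p ℕ.^ suc r) → Fin p
  head r = quotient (p ℕ.^ r)

  tail : ∀ r → Fin (p ℕ.^ suc r) → Fin (p ℕ.^ r)
  tail r = remainder {p} (p ℕ.^ r)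

  shape : ∀ r x y →
    Shape (odd? r) (U (+ 1) (+ 0) r x y) (U (+ 0) (+ 1) r x y) (W (+ 1) (+ 0) r x y) (W (+ 0) (+ 1) r x y) (Rᵖ r x y)
  shape zero    _ _ = equal-even
  shape (suc r) x y = shape-step (entries (head r x) (head r y)) (shape r (tail r x) (tail r y))

  U-sym : ∀ a c r → IsSymmetric _ (U a c r)
  W-sym : ∀ a c r → IsSymmetric _ (W a c r)
  U-sym a c zero    x y = refl
  U-sym a c (suc r) x y = cong₂ _+_
    (cong₂ _*_ (S-sym (head r x) (head r y)) (U-sym a c r (tail r x) (tail r y)))
    (cong₂ _*_ (R-sym (head r x) (head r y)) (W-sym a c r (tail r x) (tail r y)))
  W-sym a c zero    x y = refl
  W-sym a c (suc r) x y = cong (+ 1 *_) (U-sym a c r (tail r x) (tail r y))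

  Rᵖ-sym : ∀ r → IsSymmetric _ (Rᵖ r)
  Rᵖ-sym zero    x y = refl
  Rᵖ-sym (suc r) x y = cong₂ _*_ (R-sym (head r x) (head r y)) (Rᵖ-sym r (tail r x) (tail r y))

  Rᵖ-row : ∀ r x → ∑ (Rᵖ r x) ≡ + 1
  Rᵖ-row zero    x = refl
  Rᵖ-row (suc r) x = trans (∑-⊗ R (Rᵖ r) x) (cong₂ _*_ (R-row (head r x)) (Rᵖ-row r (tail r x)))

  W-row-suc : ∀ a c r x → ∑ (W a c (suc r) x) ≡ + p * ∑ (U a c r (tail r x))
  W-row-suc a c r x = trans (∑-⊗ (J {p}) (U a c r) x) (cong (_* ∑ (U a c r (tail r x))) (∑-one p))

  U-row-suc : ∀ a c r x → ∑ (U a c (suc r) x) ≡ ∑ (W a c r (tail r x))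
  U-row-suc a c r x = begin
    ∑ (U a c (suc r) x)
      ≡⟨ ∑-+ ((S ⊗ U a c r) x) _ ⟩
    ∑ ((S ⊗ U a c r) x) + ∑ ((R ⊗ W a c r) x)
      ≡⟨ cong₂ _+_ (trans (∑-⊗ S (U a c r) x) (cong (_* ∑ (U a c r (tail r x))) (S-row (head r x))))
                   (trans (∑-⊗ R (W a c r) x) (cong (_* ∑ (W a c r (tail r x))) (R-row (head r x)))) ⟩
    + 0 * ∑ (U a c r (tail r x)) + + 1 * ∑ (W a c r (tail r x))
      ≡⟨ lemma (∑ (U a c r (tail r x))) (∑ (W a c r (tail r x))) ⟩
    ∑ (W a c r (tail r x)) ∎
    where
    lemma : ∀ u w → + 0 * u + + 1 * w ≡ w
    lemma = solve-∀

  U-row-odd : ∀ {r} → Odd r → ∀ x → ∑ (U (+ 1) (+ 0) r x) ≡ + 0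
  U-row-odd one            x = U-row-suc (+ 1) (+ 0) 0 x
  U-row-odd (2+_ {r} o) x = begin
    ∑ (U (+ 1) (+ 0) (suc (suc r)) x)            ≡⟨ U-row-suc (+ 1) (+ 0) (suc r) x ⟩
    ∑ (W (+ 1) (+ 0) (suc r) (tail (suc r) x))           ≡⟨ W-row-suc (+ 1) (+ 0) r (tail (suc r) x) ⟩
    + p * ∑ (U (+ 1) (+ 0) r (tail r (tail (suc r) x)))    ≡⟨ cong (+ p *_) (U-row-odd o (tail r (tail (suc r) x))) ⟩
    + p * + 0                                    ≡⟨ ℤ.*-zeroʳ (+ p) ⟩
    + 0                                          ∎

  W-row-odd : ∀ {r} → Odd r → ∀ x → ∑ (W (+ 0) (+ 1) r x) ≡ + 0
  W-row-odd one            x = trans (W-row-suc (+ 0) (+ 1) 0 x) (ℤ.*-zeroʳ (+ p))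
  W-row-odd (2+_ {r} o) x = begin
    ∑ (W (+ 0) (+ 1) (suc (suc r)) x)            ≡⟨ W-row-suc (+ 0) (+ 1) (suc r) x ⟩
    + p * ∑ (U (+ 0) (+ 1) (suc r) (tail (suc r) x))     ≡⟨ cong (+ p *_) (U-row-suc (+ 0) (+ 1) r (tail (suc r) x)) ⟩
    + p * ∑ (W (+ 0) (+ 1) r (tail r (tail (suc r) x)))    ≡⟨ cong (+ p *_) (W-row-odd o (tail r (tail (suc r) x))) ⟩
    + p * + 0                                    ≡⟨ ℤ.*-zeroʳ (+ p) ⟩
    + 0                                          ∎

  gram-RᵖRᵖ : ∀ r x y → gram (Rᵖ r) (Rᵖ r) x y ≡ δ x y
  gram-RᵖRᵖ zero    zero zero = refl
  gram-RᵖRᵖ (suc r) x    y    = begin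
    gram (R ⊗ Rᵖ r) (R ⊗ Rᵖ r) x y     ≡⟨ gram-⊗ R R (Rᵖ r) (Rᵖ r) x y ⟩
    (gram R R ⊗ gram (Rᵖ r) (Rᵖ r)) x y ≡⟨ cong₂ _*_ (RR (head r x) (head r y)) (gram-RᵖRᵖ r (tail r x) (tail r y)) ⟩
    (_⊗_ {p} δ δ) x y                         ≡⟨ δ-⊗ p x y ⟨
    δ x y                               ∎

  gram-WW-suc : ∀ a c a′ c′ r x y →
    gram (W a c (suc r)) (W a′ c′ (suc r)) x y ≡ + p * gram (U a c r) (U a′ c′ r) (tail r x) (tail r y)
  gram-WW-suc a c a′ c′ r x y = trans (gram-⊗ (J {p}) J (U a c r) (U a′ c′ r) x y)
    (cong (_* gram (U a c r) (U a′ c′ r) (tail r x) (tail r y)) (gram-JJ (head r x) (head r y)))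

  gram-UW-suc : ∀ a c a′ c′ r x y →
    gram (U a c (suc r)) (W a′ c′ (suc r)) x y ≡ gram (W a c r) (U a′ c′ r) (tail r x) (tail r y)
  gram-UW-suc a c a′ c′ r x y = begin
    gram (U a c (suc r)) (W a′ c′ (suc r)) x y
      ≡⟨ gram-⊕⊗ˡ S R (U a c r) (W a c r) (J {p}) (U a′ c′ r) x y ⟩
    gram S (J {p}) i j * UU + gram R J i j * WU
      ≡⟨ cong₂ _+_ (cong (_* UU) (gram-SJ i j)) (cong (_* WU) (gram-RJ i j)) ⟩
    + 0 * UU + + 1 * WU
      ≡⟨ lemma UU WU ⟩
    WU ∎
    where
    i = head r x
    j = head r y
    UU = gram (U a c r) (U a′ c′ r) (tail r x) (tail r y)
    WU = gram (W a c r) (U a′ c′ r) (tail r x) (tail r y)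
    lemma : ∀ u w → + 0 * u + + 1 * w ≡ w
    lemma = solve-∀

  gram-UW : ∀ a c a′ c′ r x y →
    gram (U a c r) (W a′ c′ r) x y ≡ alternate (a * c′) (c * a′) r
  gram-WU : ∀ a c a′ c′ r x y →
    gram (W a c r) (U a′ c′ r) x y ≡ alternate (c * a′) (a * c′) r
  gram-UW a c a′ c′ zero    x y = ℤ.+-identityʳ (a * c′)
  gram-UW a c a′ c′ (suc r) x y =
    trans (gram-UW-suc a c a′ c′ r x y) (gram-WU a c a′ c′ r (tail r x) (tail r y))
  gram-WU a c a′ c′ zero    x y = ℤ.+-identityʳ (c * a′)
  gram-WU a c a′ c′ (suc r) x y = begin
    gram (W a c (suc r)) (U a′ c′ (suc r)) x y      ≡⟨ gram-swap (W a c (suc r)) (U a′ c′ (suc r)) x y ⟩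
    gram (U a′ c′ (suc r)) (W a c (suc r)) y x      ≡⟨ gram-UW-suc a′ c′ a c r y x ⟩
    gram (W a′ c′ r) (U a c r) (tail r y) (tail r x)    ≡⟨ gram-swap (W a′ c′ r) (U a c r) (tail r y) (tail r x) ⟩
    gram (U a c r) (W a′ c′ r) (tail r x) (tail r y)    ≡⟨ gram-UW a c a′ c′ r (tail r x) (tail r y) ⟩
    alternate (a * c′) (c * a′) r                   ∎

  gram-UU-suc : ∀ a c → a * c ≡ + 0 → ∀ r x y →
    gram (U a c (suc r)) (U a c (suc r)) x y ≡
      (+ p * δ (head r x) (head r y) - + 1) * gram (U a c r) (U a c r) (tail r x) (tail r y)
      + δ (head r x) (head r y) * gram (W a c r) (W a c r) (tail r x) (tail r y)
  gram-UU-suc a c ac≡0 r x y = begin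
    gram (U a c (suc r)) (U a c (suc r)) x y
      ≡⟨ gram-⊕⊗ S R (U a c r) (W a c r) S R (U a c r) (W a c r) x y ⟩
    gram S S i j * UU + gram S R i j * gram (U a c r) (W a c r) k l
      + gram R S i j * gram (W a c r) (U a c r) k l + gram R R i j * WW
      ≡⟨ cong₂ _+_ (cong₂ _+_ (cong₂ _+_ (cong (_* UU) (SS i j))
           (cong (gram S R i j *_) UW≡0)) (cong (gram R S i j *_) WU≡0)) (cong (_* WW) (RR i j)) ⟩
    (+ p * δ i j - + 1) * UU + gram S R i j * + 0 + gram R S i j * + 0 + δ i j * WW
      ≡⟨ lemma ((+ p * δ i j - + 1) * UU) (gram S R i j) (gram R S i j) (δ i j * WW) ⟩
    (+ p * δ i j - + 1) * UU + δ i j * WW ∎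
    where
    i = head r x
    j = head r y
    k = tail r x
    l = tail r y
    UU = gram (U a c r) (U a c r) k l
    WW = gram (W a c r) (W a c r) k l
    ca≡0 : c * a ≡ + 0
    ca≡0 = trans (ℤ.*-comm c a) ac≡0
    UW≡0 : gram (U a c r) (W a c r) k l ≡ + 0
    UW≡0 = trans (gram-UW a c a c r k l) (trans (cong₂ (λ u v → alternate u v r) ac≡0 ca≡0) (alternate-same (+ 0) r))
    WU≡0 : gram (W a c r) (U a c r) k l ≡ + 0
    WU≡0 = trans (gram-WU a c a c r k l) (trans (cong₂ (λ u v → alternate u v r) ca≡0 ac≡0) (alternate-same (+ 0) r))
    lemma : ∀ u v w z → u + v * + 0 + w * + 0 + z ≡ u + z
    lemma = solve-∀

  -- One step maps the column of Gram matrices (UUᵀ , WWᵀ) by the matrix N = ((pI − J , I) , (pJ , 0));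
  -- (p , 1) is a left eigenvector of N with eigenvalue pI.
  gram-UU+WW : ∀ a c → a * c ≡ + 0 → ∀ r x y →
    + p * gram (U a c r) (U a c r) x y + gram (W a c r) (W a c r) x y ≡
      + (p ℕ.^ r) * (+ p * (a * a) + c * c) * δ x y
  gram-UU+WW a c ac≡0 zero    zero zero = lemma (+ p) (a * a) (c * c)
    where
    lemma : ∀ p a c → p * (a + + 0) + (c + + 0) ≡ + 1 * (p * a + c) * + 1
    lemma = solve-∀
  gram-UU+WW a c ac≡0 (suc r) x y = begin
    + p * gram (U a c (suc r)) (U a c (suc r)) x y + gram (W a c (suc r)) (W a c (suc r)) x y
      ≡⟨ cong₂ _+_ (cong (+ p *_) (gram-UU-suc a c ac≡0 r x y)) (gram-WW-suc a c a c r x y) ⟩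
    + p * ((+ p * d - + 1) * UU + d * WW) + + p * UU
      ≡⟨ lemma₁ (+ p) d UU WW ⟩
    + p * d * (+ p * UU + WW)
      ≡⟨ cong (+ p * d *_) (gram-UU+WW a c ac≡0 r k l) ⟩
    + p * d * (+ (p ℕ.^ r) * N * δ k l)
      ≡⟨ lemma₂ (+ p) d (+ (p ℕ.^ r)) N (δ k l) ⟩
    + p * + (p ℕ.^ r) * N * (d * δ k l)
      ≡⟨ cong₂ (λ u v → u * N * v) (ℤ.pos-* p (p ℕ.^ r)) (δ-⊗ p x y) ⟨
    + (p ℕ.^ suc r) * N * δ x y ∎
    where
    k = tail r x
    l = tail r y
    d = δ (head r x) (head r y)
    N = + p * (a * a) + c * c
    UU = gram (U a c r) (U a c r) k l
    WW = gram (W a c r) (W a c r) k l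
    lemma₁ : ∀ p d u w → p * ((p * d - + 1) * u + d * w) + p * u ≡ p * d * (p * u + w)
    lemma₁ = solve-∀
    lemma₂ : ∀ p d q n e → p * d * (q * n * e) ≡ p * q * n * (d * e)
    lemma₂ = solve-∀

  -- (1 , −p) is a right eigenvector of N with eigenvalue −J.
  gram-UU-difference : ∀ r x y →
    gram (U (+ 1) (+ 0) r) (U (+ 1) (+ 0) r) x y ≡
      sign (+ 1) r + + p * gram (U (+ 0) (+ 1) r) (U (+ 0) (+ 1) r) x y
  gram-WW-difference : ∀ r x y →
    gram (W (+ 1) (+ 0) r) (W (+ 1) (+ 0) r) x y ≡
      - (+ p * sign (+ 1) r) + + p * gram (W (+ 0) (+ 1) r) (W (+ 0) (+ 1) r) x y
  gram-UU-difference zero    x y = sym (+-congˡ (+ 1) (ℤ.*-zeroʳ (+ p)))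
  gram-UU-difference (suc r) x y = begin
    gram (U (+ 1) (+ 0) (suc r)) (U (+ 1) (+ 0) (suc r)) x y
      ≡⟨ gram-UU-suc (+ 1) (+ 0) refl r x y ⟩
    (+ p * d - + 1) * gram (U (+ 1) (+ 0) r) (U (+ 1) (+ 0) r) k l + d * gram (W (+ 1) (+ 0) r) (W (+ 1) (+ 0) r) k l
      ≡⟨ cong₂ (λ u w → (+ p * d - + 1) * u + d * w) (gram-UU-difference r k l) (gram-WW-difference r k l) ⟩
    (+ p * d - + 1) * (s + + p * UU) + d * (- (+ p * s) + + p * WW)
      ≡⟨ lemma (+ p) d s UU WW ⟩
    - s + + p * ((+ p * d - + 1) * UU + d * WW)
      ≡⟨ cong (λ u → - s + + p * u) (gram-UU-suc (+ 0) (+ 1) refl r x y) ⟨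
    - s + + p * gram (U (+ 0) (+ 1) (suc r)) (U (+ 0) (+ 1) (suc r)) x y ∎
    where
    k = tail r x
    l = tail r y
    d = δ (head r x) (head r y)
    s = sign (+ 1) r
    UU = gram (U (+ 0) (+ 1) r) (U (+ 0) (+ 1) r) k l
    WW = gram (W (+ 0) (+ 1) r) (W (+ 0) (+ 1) r) k l
    lemma : ∀ p d s u w →
      (p * d - + 1) * (s + p * u) + d * (- (p * s) + p * w) ≡ - s + p * ((p * d - + 1) * u + d * w)
    lemma = solve-∀
  gram-WW-difference zero    x y = lemma (+ p)
    where
    lemma : ∀ p → + 0 ≡ - (p * + 1) + p * + 1
    lemma = solve-∀
  gram-WW-difference (suc r) x y = begin
    gram (W (+ 1) (+ 0) (suc r)) (W (+ 1) (+ 0) (suc r)) x y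
      ≡⟨ gram-WW-suc (+ 1) (+ 0) (+ 1) (+ 0) r x y ⟩
    + p * gram (U (+ 1) (+ 0) r) (U (+ 1) (+ 0) r) k l
      ≡⟨ cong (+ p *_) (gram-UU-difference r k l) ⟩
    + p * (s + + p * UU)
      ≡⟨ lemma (+ p) s UU ⟩
    - (+ p * - s) + + p * (+ p * UU)
      ≡⟨ cong (λ w → - (+ p * - s) + + p * w) (gram-WW-suc (+ 0) (+ 1) (+ 0) (+ 1) r x y) ⟨
    - (+ p * - s) + + p * gram (W (+ 0) (+ 1) (suc r)) (W (+ 0) (+ 1) (suc r)) x y ∎
    where
    k = tail r x
    l = tail r y
    s = sign (+ 1) r
    UU = gram (U (+ 0) (+ 1) r) (U (+ 0) (+ 1) r) k l
    lemma : ∀ p s u → p * (s + p * u) ≡ - (p * - s) + p * (p * u)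
    lemma = solve-∀

  gram-SᵖSᵖ : ∀ {r} → Odd r → ∀ x y → gram (Sᵖ r) (Sᵖ r) x y ≡ + (p ℕ.^ r) * δ x y - + 1
  gram-SᵖSᵖ {r} odd x y = begin
    gram (Sᵖ r) (Sᵖ r) x y
      ≡⟨ gram-⊕ A D A D x y ⟩
    gram A A x y + gram A D x y + gram D A x y + gram D D x y
      ≡⟨ cong₂ (λ u v → gram A A x y + u + v + gram D D x y)
           (trans (gram-UW (+ 1) (+ 0) (+ 0) (+ 1) r x y) (alternate-odd (+ 1) (+ 0) odd))
           (trans (gram-WU (+ 0) (+ 1) (+ 1) (+ 0) r x y) (alternate-odd (+ 1) (+ 0) odd)) ⟩
    gram A A x y + + 0 + + 0 + gram D D x y
      ≡⟨ cong (λ u → u + + 0 + + 0 + gram D D x y)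
           (trans (gram-UU-difference r x y) (cong (_+ + p * gram B B x y) (sign-odd (+ 1) odd))) ⟩
    - + 1 + + p * gram B B x y + + 0 + + 0 + gram D D x y
      ≡⟨ lemma₁ (+ p * gram B B x y) (gram D D x y) ⟩
    (+ p * gram B B x y + gram D D x y) - + 1
      ≡⟨ cong (_- + 1) (gram-UU+WW (+ 0) (+ 1) refl r x y) ⟩
    + (p ℕ.^ r) * (+ p * + 0 + + 1) * δ x y - + 1
      ≡⟨ lemma₂ (+ (p ℕ.^ r)) (+ p) (δ x y) ⟩
    + (p ℕ.^ r) * δ x y - + 1 ∎
    where
    A = U (+ 1) (+ 0) r
    B = U (+ 0) (+ 1) r
    D = W (+ 0) (+ 1) r
    lemma₁ : ∀ b d → - + 1 + b + + 0 + + 0 + d ≡ (b + d) - + 1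
    lemma₁ = solve-∀
    lemma₂ : ∀ q p d → q * (p * + 0 + + 1) * d - + 1 ≡ q * d - + 1
    lemma₂ = solve-∀

  module _ (a c s : ℤ) (a-sign : a ≡ s * a) (c-sign : c ≡ - s * c) where
    gram-URᵖ : ∀ r x y → gram (U a c r) (Rᵖ r) x y ≡ sign s r * gram (Rᵖ r) (U a c r) x y
    gram-WRᵖ : ∀ r x y → gram (W a c r) (Rᵖ r) x y ≡ - sign s r * gram (Rᵖ r) (W a c r) x y
    gram-URᵖ zero    x y = trans (lemma₁ a) (trans a-sign (cong (s *_) (lemma₂ a)))
      where
      lemma₁ : ∀ a → a * + 1 + + 0 ≡ a
      lemma₁ = solve-∀
      lemma₂ : ∀ a → a ≡ + 1 * a + + 0
      lemma₂ = solve-∀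
    gram-URᵖ (suc r) x y = begin
      gram (U a c (suc r)) (Rᵖ (suc r)) x y
        ≡⟨ gram-⊕⊗ˡ S R (U a c r) (W a c r) R (Rᵖ r) x y ⟩
      gram S R i j * gram (U a c r) (Rᵖ r) k l + gram R R i j * gram (W a c r) (Rᵖ r) k l
        ≡⟨ cong₂ _+_ (cong₂ _*_ (SR i j) (gram-URᵖ r k l)) (cong (gram R R i j *_) (gram-WRᵖ r k l)) ⟩
      - gram R S i j * (sign s r * gram (Rᵖ r) (U a c r) k l) + gram R R i j * (- sign s r * gram (Rᵖ r) (W a c r) k l)
        ≡⟨ lemma (gram R S i j) (sign s r) (gram (Rᵖ r) (U a c r) k l) (gram R R i j) (gram (Rᵖ r) (W a c r) k l) ⟩
      - sign s r * (gram R S i j * gram (Rᵖ r) (U a c r) k l + gram R R i j * gram (Rᵖ r) (W a c r) k l)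
        ≡⟨ cong (- sign s r *_) RU ⟨
      - sign s r * gram (Rᵖ (suc r)) (U a c (suc r)) x y ∎
      where
      i = head r x
      j = head r y
      k = tail r x
      l = tail r y
      RU : gram (Rᵖ (suc r)) (U a c (suc r)) x y ≡
        gram R S i j * gram (Rᵖ r) (U a c r) k l + gram R R i j * gram (Rᵖ r) (W a c r) k l
      RU = begin
        gram (Rᵖ (suc r)) (U a c (suc r)) x y
          ≡⟨ gram-swap (Rᵖ (suc r)) (U a c (suc r)) x y ⟩
        gram (U a c (suc r)) (Rᵖ (suc r)) y x
          ≡⟨ gram-⊕⊗ˡ S R (U a c r) (W a c r) R (Rᵖ r) y x ⟩
        gram S R j i * gram (U a c r) (Rᵖ r) l k + gram R R j i * gram (W a c r) (Rᵖ r) l k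
          ≡⟨ cong₂ _+_ (cong₂ _*_ (gram-swap S R j i) (gram-swap (U a c r) (Rᵖ r) l k))
                       (cong₂ _*_ (gram-swap R R j i) (gram-swap (W a c r) (Rᵖ r) l k)) ⟩
        gram R S i j * gram (Rᵖ r) (U a c r) k l + gram R R i j * gram (Rᵖ r) (W a c r) k l ∎
      lemma : ∀ z s u d w → - z * (s * u) + d * (- s * w) ≡ - s * (z * u + d * w)
      lemma = solve-∀
    gram-WRᵖ zero    x y = trans (lemma₁ c) (trans c-sign (cong (- s *_) (lemma₂ c)))
      where
      lemma₁ : ∀ a → a * + 1 + + 0 ≡ a
      lemma₁ = solve-∀
      lemma₂ : ∀ a → a ≡ + 1 * a + + 0
      lemma₂ = solve-∀
    gram-WRᵖ (suc r) x y = begin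
      gram (W a c (suc r)) (Rᵖ (suc r)) x y
        ≡⟨ gram-⊗ (J {p}) R (U a c r) (Rᵖ r) x y ⟩
      gram J R i j * gram (U a c r) (Rᵖ r) k l
        ≡⟨ cong₂ _*_ (gram-JR i j) (gram-URᵖ r k l) ⟩
      + 1 * (sign s r * gram (Rᵖ r) (U a c r) k l)
        ≡⟨ lemma (sign s r) (gram (Rᵖ r) (U a c r) k l) ⟩
      - - sign s r * (+ 1 * gram (Rᵖ r) (U a c r) k l)
        ≡⟨ cong (λ z → - - sign s r * (z * gram (Rᵖ r) (U a c r) k l)) (gram-RJ i j) ⟨
      - - sign s r * (gram R J i j * gram (Rᵖ r) (U a c r) k l)
        ≡⟨ cong (- - sign s r *_) (gram-⊗ R (J {p}) (Rᵖ r) (U a c r) x y) ⟨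
      - - sign s r * gram (Rᵖ (suc r)) (W a c (suc r)) x y ∎
      where
      i = head r x
      j = head r y
      k = tail r x
      l = tail r y
      lemma : ∀ s u → + 1 * (s * u) ≡ - - s * (+ 1 * u)
      lemma = solve-∀

  gram-SᵖRᵖ : ∀ {r} → Odd r → ∀ x y → gram (Sᵖ r) (Rᵖ r) x y ≡ - gram (Rᵖ r) (Sᵖ r) x y
  gram-SᵖRᵖ {r} odd x y = begin
    gram (Sᵖ r) (Rᵖ r) x y
      ≡⟨ split x y ⟩
    gram A (Rᵖ r) x y + gram D (Rᵖ r) x y
      ≡⟨ cong₂ _+_
           (trans (gram-URᵖ (+ 1) (+ 0) (+ 1) refl refl r x y) (cong (_* gram (Rᵖ r) A x y) (sign-odd (+ 1) odd)))
           (trans (gram-WRᵖ (+ 0) (+ 1) (- + 1) refl refl r x y) (cong (λ z → - z * gram (Rᵖ r) D x y) (sign-odd (- + 1) odd))) ⟩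
    - + 1 * gram (Rᵖ r) A x y + - + 1 * gram (Rᵖ r) D x y
      ≡⟨ lemma (gram (Rᵖ r) A x y) (gram (Rᵖ r) D x y) ⟩
    - (gram (Rᵖ r) A x y + gram (Rᵖ r) D x y)
      ≡⟨ cong -_ (cong₂ _+_ (gram-swap (Rᵖ r) A x y) (gram-swap (Rᵖ r) D x y)) ⟩
    - (gram A (Rᵖ r) y x + gram D (Rᵖ r) y x)
      ≡⟨ cong -_ (split y x) ⟨
    - gram (Sᵖ r) (Rᵖ r) y x
      ≡⟨ cong -_ (gram-swap (Sᵖ r) (Rᵖ r) y x) ⟩
    - gram (Rᵖ r) (Sᵖ r) x y ∎
    where
    A = U (+ 1) (+ 0) r
    D = W (+ 0) (+ 1) r
    split : ∀ x y → gram (Sᵖ r) (Rᵖ r) x y ≡ gram A (Rᵖ r) x y + gram D (Rᵖ r) x y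
    split x y = trans (∑-cong (λ k → ℤ.*-distribʳ-+ (Rᵖ r y k) (A x k) (D x k))) (∑-+ (λ k → A x k * Rᵖ r y k) _)
    lemma : ∀ a d → - + 1 * a + - + 1 * d ≡ - (a + d)
    lemma = solve-∀

  letter-odd : ∀ {a b c d ρ} → Shape true a b c d ρ → Letter (a + d) ρ
  letter-odd equal-odd             = inj₁ (refl , refl)
  letter-odd (left {a = a} pa pc)  = inj₂ (refl , subst IsPM1 (sym (ℤ.+-identityʳ a)) pa)
  letter-odd (right {d = d} pb pd) = inj₂ (refl , subst IsPM1 (sym (ℤ.+-identityˡ d)) pd)

  power : ∀ {r} → Odd r → Core (Sᵖ r) (Rᵖ r)
  power {r} odd = record
    { S-sym   = λ x y → cong₂ _+_ (U-sym (+ 1) (+ 0) r x y) (W-sym (+ 0) (+ 1) r x y)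
    ; R-sym   = Rᵖ-sym r
    ; SS      = gram-SᵖSᵖ odd
    ; RR      = gram-RᵖRᵖ r
    ; SR      = gram-SᵖRᵖ odd
    ; S-row   = λ x → trans (∑-+ (U (+ 1) (+ 0) r x) _) (cong₂ _+_ (U-row-odd odd x) (W-row-odd odd x))
    ; R-row   = Rᵖ-row r
    ; entries = λ x y → letter-odd (subst
        (λ o → Shape o (U (+ 1) (+ 0) r x y) (U (+ 0) (+ 1) r x y) (W (+ 1) (+ 0) r x y) (W (+ 0) (+ 1) r x y) (Rᵖ r x y))
        (odd?-odd odd) (shape r x y))
    }

-- Paley cores of prime order

module _ {c ℓ} (M : CommutativeMonoid c ℓ) where
  open CommutativeMonoid M using (Carrier; _≈_; reflexive; ∙-congˡ)
    renaming (refl to ≈-refl; sym to ≈-sym; trans to ≈-trans)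
  open Sum M using (sum; sum-remove; sum-cong-≗)

  sum-injective : (f : Fin n → Carrier) (σ : Fin n → Fin n) →
    (∀ i j → σ i ≡ σ j → i ≡ j) → sum (f ∘ σ) ≈ sum f
  sum-injective {zero}  f σ inj = ≈-refl
  sum-injective {suc n} f σ inj = ≈-sym (≈-trans (sum-remove {i = σ zero} f) (∙-congˡ
    (≈-sym (≈-trans (reflexive (sum-cong-≗ (λ i → cong f (sym (Fin.punchIn-punchOut (σ0≢ i))))))
      (sum-injective (f ∘ punchIn (σ zero)) τ τ-inj)))))
    where
    σ0≢ : ∀ i → σ zero ≢ σ (suc i)
    σ0≢ i eq with inj zero (suc i) eq
    ... | ()
    τ : Fin n → Fin n
    τ i = punchOut (σ0≢ i)
    τ-inj : ∀ i j → τ i ≡ τ j → i ≡ j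
    τ-inj i j eq = Fin.suc-injective (inj (suc i) (suc j) (Fin.punchOut-injective (σ0≢ i) (σ0≢ j) eq))

module Congruence (p′ : ℕ) where
  p : ℕ
  p = suc p′

  infix 4 _∼_

  record _∼_ (x y : ℤ) : Set where
    constructor congruent
    field p∣x-y : + p ∣ x - y

  open _∼_

  ∼-by : ∀ {x y z w} → x - y ≡ z - w → x ∼ y → z ∼ w
  ∼-by eq (congruent d) = congruent (subst (+ p ∣_) eq d)

  ∼-reflexive : ∀ {x y} → x ≡ y → x ∼ y
  ∼-reflexive {x} refl = congruent (divides (+ 0) (ℤ.+-inverseʳ x))

  ∼-refl : ∀ {x} → x ∼ x
  ∼-refl = ∼-reflexive refl

  ∼-sym : ∀ {x y} → x ∼ y → y ∼ x
  ∼-sym {x} {y} (congruent d) = congruent (subst (+ p ∣_) (lemma x y) (∣m⇒∣-m d))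
    where
    lemma : ∀ x y → - (x - y) ≡ y - x
    lemma = solve-∀

  ∼-trans : ∀ {x y z} → x ∼ y → y ∼ z → x ∼ z
  ∼-trans {x} {y} {z} (congruent d) (congruent e) = congruent (subst (+ p ∣_) (lemma x y z) (∣m∣n⇒∣m+n d e))
    where
    lemma : ∀ x y z → (x - y) + (y - z) ≡ x - z
    lemma = solve-∀

  ∼-+ : ∀ {x y z w} → x ∼ y → z ∼ w → x + z ∼ y + w
  ∼-+ {x} {y} {z} {w} (congruent d) (congruent e) =
    congruent (subst (+ p ∣_) (lemma x y z w) (∣m∣n⇒∣m+n d e))
    where
    lemma : ∀ x y z w → (x - y) + (z - w) ≡ (x + z) - (y + w)
    lemma = solve-∀

  ∼-* : ∀ {x y z w} → x ∼ y → z ∼ w → x * z ∼ y * w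
  ∼-* {x} {y} {z} {w} (congruent d) (congruent e) =
    congruent (subst (+ p ∣_) (lemma x y z w) (∣m∣n⇒∣m+n (∣m⇒∣m*n z d) (∣n⇒∣m*n y e)))
    where
    lemma : ∀ x y z w → (x - y) * z + y * (z - w) ≡ (x * z) - (y * w)
    lemma = solve-∀

  ∼-^ : ∀ {x y} n → x ∼ y → x ^ n ∼ y ^ n
  ∼-^ zero    d = ∼-refl
  ∼-^ (suc n) d = ∼-* d (∼-^ n d)

  ∼0⇒∣ : ∀ {x} → x ∼ + 0 → + p ∣ x
  ∼0⇒∣ {x} (congruent d) = subst (+ p ∣_) (ℤ.+-identityʳ x) d

  ∣⇒∼0 : ∀ {x} → + p ∣ x → x ∼ + 0
  ∣⇒∼0 {x} d = congruent (subst (+ p ∣_) (sym (ℤ.+-identityʳ x)) d)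

  p∼0 : + p ∼ + 0
  p∼0 = congruent (divides (+ 1) (lemma (+ p)))
    where
    lemma : ∀ z → z - + 0 ≡ + 1 * z
    lemma = solve-∀

  ordered-mod : ∀ {a b} → a ℕ.≤ b → b ℕ.< p → + b ∼ + a → b ≡ a
  ordered-mod {a} {b} a≤b b<p d with b ℕ.∸ a in eq
  ... | zero  = ℕ.≤-antisym (ℕ.m∸n≡0⇒m≤n eq) a≤b
  ... | suc k = contradiction
    (subst (p ℕ.∣_) (trans (cong ∣_∣ (trans (ℤ.m-n≡m⊖n b a) (ℤ.⊖-≥ a≤b))) eq) (∣⇒∣ᵤ (p∣x-y d)))
    (ℕ.>⇒∤ (ℕ.≤-<-trans (subst (ℕ._≤ b) eq (ℕ.m∸n≤m b a)) b<p))

  +-injective-mod : ∀ {a b} → a ℕ.< p → b ℕ.< p → + a ∼ + b → a ≡ b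
  +-injective-mod {a} {b} a<p b<p a∼b with ℕ.≤-total a b
  ... | inj₁ a≤b = sym (ordered-mod a≤b b<p (∼-sym a∼b))
  ... | inj₂ b≤a = (ordered-mod b≤a a<p a∼b)

  toℕ-injective-mod : ∀ (i j : Fin p) → + toℕ i ∼ + toℕ j → i ≡ j
  toℕ-injective-mod i j d = Fin.toℕ-injective (+-injective-mod (Fin.toℕ<n i) (Fin.toℕ<n j) d)

  residue : ℤ → Fin p
  residue z = fromℕ< (n%ℕd<d z p)

  residue-∼ : ∀ z → z ∼ + toℕ (residue z)
  residue-∼ z = congruent (divides (z /ℕ p) (begin
    z - + toℕ (residue z)
      ≡⟨ cong₂ (λ u v → u - + v) (a≡a%ℕn+[a/ℕn]*n z p) (Fin.toℕ-fromℕ< (n%ℕd<d z p)) ⟩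
    + (z %ℕ p) + (z /ℕ p) * + p - + (z %ℕ p)
      ≡⟨ lemma (+ (z %ℕ p)) _ ⟩
    (z /ℕ p) * + p ∎))
    where
    lemma : ∀ a b → a + b - a ≡ b
    lemma = solve-∀

  residue-cong : ∀ {x y} → x ∼ y → residue x ≡ residue y
  residue-cong {x} {y} d =
    toℕ-injective-mod _ _ (∼-trans (∼-sym (residue-∼ x)) (∼-trans d (residue-∼ y)))

  residue-toℕ : ∀ i → residue (+ toℕ i) ≡ i
  residue-toℕ i = toℕ-injective-mod _ _ (∼-sym (residue-∼ (+ toℕ i)))

  module _ {c ℓ} (M : CommutativeMonoid c ℓ) where
    open CommutativeMonoid M using (Carrier; _≈_) renaming (sym to ≈-sym; trans to ≈-trans)
    open Sum M using (sum; sum-cong-≋)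

    sum-reindex : (f : ℤ → Carrier) → (∀ {x y} → x ∼ y → f x ≈ f y) →
      (h : Fin p → ℤ) → (∀ i j → h i ∼ h j → i ≡ j) → sum (f ∘ h) ≈ sum {p} (λ i → f (+ toℕ i))
    sum-reindex f f-cong h h-inj = ≈-trans
      (sum-cong-≋ (λ i → f-cong (residue-∼ (h i))))
      (sum-injective M (λ i → f (+ toℕ i)) (residue ∘ h) inj)
      where
      inj : ∀ i j → residue (h i) ≡ residue (h j) → i ≡ j
      inj i j eq = h-inj i j (∼-trans (residue-∼ (h i))
        (∼-trans (∼-reflexive (cong (λ k → + toℕ k) eq)) (∼-sym (residue-∼ (h j)))))

module Σ = Sum ℤ.+-0-commutativeMonoid
module Π = Sum ℤ.*-1-commutativeMonoid

∑≡sum : (f : Fin n → ℤ) → ∑ f ≡ Σ.sum f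
∑≡sum {zero}  f = refl
∑≡sum {suc n} f = +-congˡ (f zero) (∑≡sum (f ∘ suc))

∑-comm : (f : Fin m → Fin n → ℤ) → (∑ λ i → ∑ λ j → f i j) ≡ ∑ λ j → ∑ λ i → f i j
∑-comm f = trans (to-sum f) (trans (Σ.∑-comm f) (sym (to-sum (λ j i → f i j))))
  where
  to-sum : ∀ {m n} (f : Fin m → Fin n → ℤ) → (∑ λ i → ∑ λ j → f i j) ≡ Σ.sum λ i → Σ.sum λ j → f i j
  to-sum f = trans (∑-cong (λ i → ∑≡sum (f i))) (∑≡sum (λ i → Σ.sum (f i)))

module Field (p′ : ℕ) (2≤p′ : 2 ℕ.≤ p′) (prime : Prime (suc p′)) where
  open Congruence p′ public

  euclid : ∀ x y → x * y ∼ + 0 → x ∼ + 0 ⊎ y ∼ + 0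
  euclid x y d with euclidsLemma ∣ x ∣ ∣ y ∣ prime (subst (p ℕ.∣_) (ℤ.abs-* x y) (∣⇒∣ᵤ (∼0⇒∣ d)))
  ... | inj₁ e = inj₁ (∣⇒∼0 (∣ᵤ⇒∣ e))
  ... | inj₂ e = inj₂ (∣⇒∼0 (∣ᵤ⇒∣ e))

  ∼-cancelˡ : ∀ {a} x y → ¬ a ∼ + 0 → a * x ∼ a * y → x ∼ y
  ∼-cancelˡ {a} x y a≁0 d with euclid a (x - y) (∼-by (lemma a x y) d)
    where
    lemma : ∀ a x y → a * x - a * y ≡ a * (x - y) - + 0
    lemma = solve-∀
  ... | inj₁ e = contradiction e a≁0
  ... | inj₂ e = congruent (∼0⇒∣ e)

  suc≁0 : (i : Fin p′) → ¬ + suc (toℕ i) ∼ + 0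
  suc≁0 i d with toℕ-injective-mod (suc i) zero d
  ... | ()

  product≁0 : (f : Fin n → ℤ) → (∀ i → ¬ f i ∼ + 0) → ¬ Π.sum f ∼ + 0
  product≁0 {zero}  f f≁0 d with +-injective-mod {1} {0} (ℕ.s≤s (ℕ.≤-trans (ℕ.s≤s ℕ.z≤n) 2≤p′)) (ℕ.s≤s ℕ.z≤n) d
  ... | ()
  product≁0 {suc n} f f≁0 d with euclid (f zero) (Π.sum (f ∘ suc)) d
  ... | inj₁ e = f≁0 zero e
  ... | inj₂ e = product≁0 (f ∘ suc) (f≁0 ∘ suc) e

  product-scale : ∀ a (f g : Fin n → ℤ) → (∀ i → f i ∼ a * g i) → Π.sum f ∼ a ^ n * Π.sum g
  product-scale {zero}  a f g f∼ag = ∼-refl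
  product-scale {suc n} a f g f∼ag = ∼-trans
    (∼-* (f∼ag zero) (product-scale a (f ∘ suc) (g ∘ suc) (f∼ag ∘ suc)))
    (∼-reflexive (lemma a (g zero) (a ^ n) (Π.sum (g ∘ suc))))
    where
    lemma : ∀ a x b y → a * x * (b * y) ≡ a * b * (x * y)
    lemma = solve-∀

  nonzero-part : Fin p → ℤ
  nonzero-part zero    = + 1
  nonzero-part (suc i) = + suc (toℕ i)

  nonzero-part-residue : ∀ {z} → ¬ z ∼ + 0 → nonzero-part (residue z) ∼ z
  nonzero-part-residue {z} z≁0 with residue z in eq
  ... | zero  = contradiction (∼-trans (residue-∼ z) (∼-reflexive (cong (λ i → + toℕ i) eq))) z≁0
  ... | suc i = ∼-sym (∼-trans (residue-∼ z) (∼-reflexive (cong (λ i → + toℕ i) eq)))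

  fermat : ∀ {a} → ¬ a ∼ + 0 → a ^ p′ ∼ + 1
  fermat {a} a≁0 = ∼-cancelˡ (a ^ p′) (+ 1) (product≁0 (λ i → + suc (toℕ i)) suc≁0)
    (∼-sym (∼-trans (∼-reflexive (trans (ℤ.*-identityʳ N) N≡)) (∼-trans
      (product-scale a (λ i → f (a * + suc (toℕ i))) (λ i → + suc (toℕ i)) scaled)
      (∼-reflexive (ℤ.*-comm (a ^ p′) N)))))
    where
    f : ℤ → ℤ
    f = nonzero-part ∘ residue
    N : ℤ
    N = Π.sum {p′} (λ i → + suc (toℕ i))
    scaled : ∀ i → f (a * + suc (toℕ i)) ∼ a * + suc (toℕ i)
    scaled i = nonzero-part-residue λ d → case (euclid a (+ suc (toℕ i)) d)
      where
      case : a ∼ + 0 ⊎ + suc (toℕ i) ∼ + 0 → _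
      case (inj₁ e) = a≁0 e
      case (inj₂ e) = suc≁0 i e
    N≡ : N ≡ Π.sum {p′} (λ i → f (a * + suc (toℕ i)))
    N≡ = begin
      N
        ≡⟨ ℤ.*-identityˡ N ⟨
      Π.sum nonzero-part
        ≡⟨ Π.sum-cong-≗ (λ i → cong nonzero-part (residue-toℕ i)) ⟨
      Π.sum {p} (λ i → f (+ toℕ i))
        ≡⟨ sum-reindex ℤ.*-1-commutativeMonoid f (cong nonzero-part ∘ residue-cong) (λ i → a * + toℕ i)
             (λ i j d → toℕ-injective-mod i j (∼-cancelˡ (+ toℕ i) (+ toℕ j) a≁0 d)) ⟨
      f (a * + 0) * Π.sum {p′} (λ i → f (a * + suc (toℕ i)))
        ≡⟨ cong (λ z → f z * Π.sum {p′} (λ i → f (a * + suc (toℕ i)))) (ℤ.*-zeroʳ a) ⟩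
      f (+ 0) * Π.sum {p′} (λ i → f (a * + suc (toℕ i)))
        ≡⟨ cong (λ i → nonzero-part i * Π.sum {p′} (λ i → f (a * + suc (toℕ i)))) (residue-toℕ zero) ⟩
      + 1 * Π.sum {p′} (λ i → f (a * + suc (toℕ i)))
        ≡⟨ ℤ.*-identityˡ _ ⟩
      Π.sum {p′} (λ i → f (a * + suc (toℕ i))) ∎

Trit : ℤ → Set
Trit c = c ≡ + 0 ⊎ IsPM1 c

Trit-* : ∀ {a b} → Trit a → Trit b → Trit (a * b)
Trit-*     (inj₁ refl) tb          = inj₁ refl
Trit-* {a} (inj₂ pa)   (inj₁ refl) = inj₁ (ℤ.*-zeroʳ a)
Trit-*     (inj₂ pa)   (inj₂ pb)   = inj₂ (IsPM1-* pa pb)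

Trit-shift : ∀ {c} → Trit c → ∃[ n ] (n ℕ.≤ 2 × + 1 + c ≡ + n)
Trit-shift (inj₁ refl)        = 1 , ℕ.s≤s ℕ.z≤n , refl
Trit-shift (inj₂ (inj₁ refl)) = 2 , ℕ.≤-refl , refl
Trit-shift (inj₂ (inj₂ refl)) = 0 , ℕ.z≤n , refl

z≡-z⇒z≡0 : ∀ {z} → z ≡ - z → z ≡ + 0
z≡-z⇒z≡0 {+ zero} _ = refl

PM1-square : ∀ {c} → IsPM1 c → c * c ≡ + 1
PM1-square (inj₁ refl) = refl
PM1-square (inj₂ refl) = refl

-1^odd : ∀ l → (- + 1) ^ suc (l ℕ.+ l) ≡ - + 1
-1^odd zero    = refl
-1^odd (suc l) rewrite ℕ.+-suc l l | -1^odd l = refl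

^-*-distrib : ∀ x y n → (x * y) ^ n ≡ x ^ n * y ^ n
^-*-distrib x y zero    = refl
^-*-distrib x y (suc n) = trans (cong (x * y *_) (^-*-distrib x y n)) (lemma x y (x ^ n) (y ^ n))
  where
  lemma : ∀ a b c d → a * b * (c * d) ≡ a * c * (b * d)
  lemma = solve-∀

module Paley (l : ℕ) (prime : Prime (suc (suc (l ℕ.+ l) ℕ.+ suc (l ℕ.+ l)))) where
  h p′ : ℕ
  h  = suc (l ℕ.+ l)
  p′ = h ℕ.+ h

  2≤p′ : 2 ℕ.≤ p′
  2≤p′ = ℕ.+-mono-≤ {1} {h} {1} {h} (ℕ.s≤s ℕ.z≤n) (ℕ.s≤s ℕ.z≤n)

  open Field p′ 2≤p′ prime

  Trit-unique : ∀ {c d} → Trit c → Trit d → c ∼ d → c ≡ d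
  Trit-unique {c} {d} tc td c∼d with Trit-shift tc | Trit-shift td
  ... | m , m≤2 , 1+c≡m | n , n≤2 , 1+d≡n = begin
    c               ≡⟨ lemma c ⟨
    + 1 + c - + 1   ≡⟨ cong (_- + 1) 1+c≡1+d ⟩
    + 1 + d - + 1   ≡⟨ lemma d ⟩
    d               ∎
    where
    lemma : ∀ c → + 1 + c - + 1 ≡ c
    lemma = solve-∀
    small : ∀ {n} → n ℕ.≤ 2 → n ℕ.< p
    small n≤2 = ℕ.s≤s (ℕ.≤-trans n≤2 2≤p′)
    1+c≡1+d : + 1 + c ≡ + 1 + d
    1+c≡1+d = trans 1+c≡m (trans (cong +_ (+-injective-mod (small m≤2) (small n≤2)
      (subst₂ _∼_ 1+c≡m 1+d≡n (∼-+ (∼-refl {+ 1}) c∼d)))) (sym 1+d≡n))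

  euler : ∀ z → ∃[ c ] ((z ∼ + 0 × c ≡ + 0) ⊎ (¬ z ∼ + 0 × IsPM1 c)) × z ^ h ∼ c
  euler z with + p ∣? z - + 0
  ... | yes p∣z = + 0 , inj₁ (congruent p∣z , refl) , ∼-* {z} {+ 0} (congruent p∣z) (∼-refl {z ^ (l ℕ.+ l)})
  ... | no p∤z  = case (euclid (z ^ h - + 1) (z ^ h + + 1) factored)
    where
    z≁0 : ¬ z ∼ + 0
    z≁0 (congruent d) = p∤z d
    lemma : ∀ w → w * w - + 1 ≡ (w - + 1) * (w + + 1) - + 0
    lemma = solve-∀
    factored : (z ^ h - + 1) * (z ^ h + + 1) ∼ + 0
    factored = ∼-by (trans (cong (_- + 1) (ℤ.^-distribˡ-+-* z h h)) (lemma (z ^ h))) (fermat z≁0)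
    lemma- : ∀ w → w - + 1 - + 0 ≡ w - + 1
    lemma- = solve-∀
    lemma+ : ∀ w → w + + 1 - + 0 ≡ w - - + 1
    lemma+ = solve-∀
    case : z ^ h - + 1 ∼ + 0 ⊎ z ^ h + + 1 ∼ + 0 → _
    case (inj₁ d) = + 1 , inj₂ (z≁0 , inj₁ refl) , ∼-by (lemma- (z ^ h)) d
    case (inj₂ d) = - + 1 , inj₂ (z≁0 , inj₂ refl) , ∼-by (lemma+ (z ^ h)) d

  abstract
    χ : ℤ → ℤ
    χ z = proj₁ (euler z)

    χ-values : ∀ z → (z ∼ + 0 × χ z ≡ + 0) ⊎ (¬ z ∼ + 0 × IsPM1 (χ z))
    χ-values z = proj₁ (proj₂ (euler z))

    χ-∼ : ∀ z → z ^ h ∼ χ z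
    χ-∼ z = proj₂ (proj₂ (euler z))

  χ-zero : ∀ {z} → z ∼ + 0 → χ z ≡ + 0
  χ-zero {z} z∼0 with χ-values z
  ... | inj₁ (_ , χz≡0) = χz≡0
  ... | inj₂ (z≁0 , _)  = contradiction z∼0 z≁0

  χ-nonzero : ∀ {z} → ¬ z ∼ + 0 → IsPM1 (χ z)
  χ-nonzero {z} z≁0 with χ-values z
  ... | inj₁ (z∼0 , _) = contradiction z∼0 z≁0
  ... | inj₂ (_ , pm)  = pm

  χ-trit : ∀ z → Trit (χ z)
  χ-trit z with χ-values z
  ... | inj₁ (_ , χz≡0) = inj₁ χz≡0
  ... | inj₂ (_ , pm)   = inj₂ pm

  χ-cong : ∀ {x y} → x ∼ y → χ x ≡ χ y
  χ-cong {x} {y} x∼y = Trit-unique (χ-trit x) (χ-trit y)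
    (∼-trans (∼-sym (χ-∼ x)) (∼-trans (∼-^ h x∼y) (χ-∼ y)))

  χ-* : ∀ x y → χ (x * y) ≡ χ x * χ y
  χ-* x y = Trit-unique (χ-trit (x * y)) (Trit-* (χ-trit x) (χ-trit y))
    (∼-trans (∼-sym (χ-∼ (x * y))) (∼-trans (∼-reflexive (^-*-distrib x y h)) (∼-* (χ-∼ x) (χ-∼ y))))

  -- p ≡ 3 (mod 4), so −1 is not a square.
  χ-1 : χ (- + 1) ≡ - + 1
  χ-1 = Trit-unique (χ-trit (- + 1)) (inj₂ (inj₂ refl))
    (∼-trans (∼-sym (χ-∼ (- + 1))) (∼-reflexive (-1^odd l)))

  χ-neg : ∀ x → χ (- x) ≡ - χ x
  χ-neg x = begin
    χ (- x)          ≡⟨ cong χ (ℤ.-1*i≡-i x) ⟨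
    χ (- + 1 * x)    ≡⟨ χ-* (- + 1) x ⟩
    χ (- + 1) * χ x  ≡⟨ cong (_* χ x) χ-1 ⟩
    - + 1 * χ x      ≡⟨ ℤ.-1*i≡-i (χ x) ⟩
    - χ x            ∎

  ∑-reindex : (f : ℤ → ℤ) → (∀ {x y} → x ∼ y → f x ≡ f y) →
    (g : Fin p → ℤ) → (∀ i j → g i ∼ g j → i ≡ j) → ∑ (λ i → f (g i)) ≡ ∑ {p} (λ i → f (+ toℕ i))
  ∑-reindex f f-cong g g-inj = begin
    ∑ (λ i → f (g i))           ≡⟨ ∑≡sum (λ i → f (g i)) ⟩
    Σ.sum (λ i → f (g i))       ≡⟨ sum-reindex ℤ.+-0-commutativeMonoid f f-cong g g-inj ⟩
    Σ.sum {p} (λ i → f (+ toℕ i)) ≡⟨ ∑≡sum {p} (λ i → f (+ toℕ i)) ⟨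
    ∑ {p} (λ i → f (+ toℕ i))   ∎

  +-injective-∼ : ∀ a (i j : Fin p) → a + + toℕ i ∼ a + + toℕ j → i ≡ j
  +-injective-∼ a i j d = toℕ-injective-mod i j (∼-by (lemma a (+ toℕ i) (+ toℕ j)) d)
    where
    lemma : ∀ a x y → a + x - (a + y) ≡ x - y
    lemma = solve-∀

  ∑-χ : ∑ {p} (λ k → χ (+ toℕ k)) ≡ + 0
  ∑-χ = z≡-z⇒z≡0 (begin
    ∑ {p} (λ k → χ (+ toℕ k))         ≡⟨ ∑-reindex χ χ-cong (λ k → - + toℕ k) neg-injective ⟨
    ∑ {p} (λ k → χ (- + toℕ k))       ≡⟨ ∑-cong {p} (λ k → trans (χ-neg (+ toℕ k)) (sym (ℤ.-1*i≡-i (χ (+ toℕ k))))) ⟩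
    ∑ {p} (λ k → - + 1 * χ (+ toℕ k)) ≡⟨ ∑-*ˡ {p} (- + 1) (λ k → χ (+ toℕ k)) ⟩
    - + 1 * ∑ {p} (λ k → χ (+ toℕ k)) ≡⟨ ℤ.-1*i≡-i (∑ {p} (λ k → χ (+ toℕ k))) ⟩
    - ∑ {p} (λ k → χ (+ toℕ k))       ∎)
    where
    neg-injective : ∀ (i j : Fin p) → - + toℕ i ∼ - + toℕ j → i ≡ j
    neg-injective i j d = toℕ-injective-mod i j (∼-sym (∼-by (lemma (+ toℕ i) (+ toℕ j)) d))
      where
      lemma : ∀ x y → - x - - y ≡ y - x
      lemma = solve-∀

  ∑-χ-shift : ∀ a → ∑ {p} (λ k → χ (a + + toℕ k)) ≡ + 0
  ∑-χ-shift a = trans (∑-reindex χ χ-cong (λ k → a + + toℕ k) (+-injective-∼ a)) ∑-χ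

  correlation : ℤ → ℤ
  correlation c = ∑ {p} λ k → χ (+ toℕ k) * χ (c + + toℕ k)

  correlation-zero : correlation (+ 0) ≡ + p′
  correlation-zero = begin
    χ (+ 0) * χ (+ 0) + ∑ {p′} (λ k → χ (+ suc (toℕ k)) * χ (+ suc (toℕ k)))
      ≡⟨ cong₂ _+_ (cong (_* χ (+ 0)) (χ-zero {+ 0} (∼-refl))) (∑-cong (λ k → PM1-square (χ-nonzero (suc≁0 k)))) ⟩
    + 0 + ∑ {p′} (λ _ → + 1)
      ≡⟨ ℤ.+-identityˡ _ ⟩
    ∑ {p′} (λ _ → + 1)
      ≡⟨ ∑-one p′ ⟩
    + p′ ∎

  correlation-scale : ∀ {c} → ¬ c ∼ + 0 → correlation c ≡ correlation (+ 1)
  correlation-scale {c} c≁0 = begin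
    correlation c
      ≡⟨ ∑-reindex (λ z → χ z * χ (c + z))
           (λ d → cong₂ _*_ (χ-cong d) (χ-cong (∼-+ (∼-refl {c}) d)))
           (λ k → c * + toℕ k) (λ i j d → toℕ-injective-mod i j (∼-cancelˡ (+ toℕ i) (+ toℕ j) c≁0 d)) ⟨
    ∑ {p} (λ k → χ (c * + toℕ k) * χ (c + c * + toℕ k))
      ≡⟨ ∑-cong {p} (λ k → step (+ toℕ k)) ⟩
    correlation (+ 1) ∎
    where
    factor : ∀ c x → c + c * x ≡ c * (+ 1 + x)
    factor = solve-∀
    regroup : ∀ a b d → a * b * (a * d) ≡ a * a * (b * d)
    regroup = solve-∀
    step : ∀ x → χ (c * x) * χ (c + c * x) ≡ χ x * χ (+ 1 + x)
    step x = begin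
      χ (c * x) * χ (c + c * x)        ≡⟨ cong₂ _*_ (χ-* c x) (trans (cong χ (factor c x)) (χ-* c (+ 1 + x))) ⟩
      χ c * χ x * (χ c * χ (+ 1 + x))  ≡⟨ regroup (χ c) (χ x) (χ (+ 1 + x)) ⟩
      χ c * χ c * (χ x * χ (+ 1 + x))  ≡⟨ cong (_* (χ x * χ (+ 1 + x))) (PM1-square (χ-nonzero c≁0)) ⟩
      + 1 * (χ x * χ (+ 1 + x))        ≡⟨ ℤ.*-identityˡ _ ⟩
      χ x * χ (+ 1 + x)                ∎

  -- All nonzero shifts correlate equally, and the sum over all shifts factors as (∑ χ)² = 0.
  correlation-one : correlation (+ 1) ≡ - + 1
  correlation-one = begin
    correlation (+ 1)                  ≡⟨ lemma₂ (correlation (+ 1)) ⟩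
    (+ 1 + correlation (+ 1)) - + 1    ≡⟨ cong (_- + 1) (ℤ.*-cancelˡ-≡ (+ p′) _ (+ 0) (trans p′*≡0 (sym (ℤ.*-zeroʳ (+ p′))))) ⟩
    + 0 - + 1                          ∎
    where
    lemma₁ : ∀ q g → q * (+ 1 + g) ≡ q + g * q
    lemma₁ = solve-∀
    lemma₂ : ∀ g → g ≡ (+ 1 + g) - + 1
    lemma₂ = solve-∀
    total : ∑ {p} (λ c → correlation (+ toℕ c)) ≡ + 0
    total = begin
      ∑ {p} (λ c → correlation (+ toℕ c))
        ≡⟨ ∑-comm {p} {p} (λ c k → χ (+ toℕ k) * χ (+ toℕ c + + toℕ k)) ⟩
      (∑ {p} λ k → ∑ {p} λ c → χ (+ toℕ k) * χ (+ toℕ c + + toℕ k))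
        ≡⟨ ∑-zero {p} _ (λ k → trans (∑-*ˡ {p} (χ (+ toℕ k)) (λ c → χ (+ toℕ c + + toℕ k)))
             (trans (cong (χ (+ toℕ k) *_) (trans (∑-cong {p} (λ c → cong χ (ℤ.+-comm (+ toℕ c) (+ toℕ k)))) (∑-χ-shift (+ toℕ k))))
               (ℤ.*-zeroʳ (χ (+ toℕ k))))) ⟩
      + 0 ∎
    p′*≡0 : + p′ * (+ 1 + correlation (+ 1)) ≡ + 0
    p′*≡0 = begin
      + p′ * (+ 1 + correlation (+ 1))
        ≡⟨ lemma₁ (+ p′) (correlation (+ 1)) ⟩
      + p′ + correlation (+ 1) * + p′
        ≡⟨ cong₂ _+_ correlation-zero (cong (correlation (+ 1) *_) (∑-one p′)) ⟨
      correlation (+ 0) + correlation (+ 1) * ∑ {p′} (λ _ → + 1)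
        ≡⟨ +-congˡ (correlation (+ 0)) (∑-*ˡ {p′} (correlation (+ 1)) (λ _ → + 1)) ⟨
      correlation (+ 0) + ∑ {p′} (λ _ → correlation (+ 1) * + 1)
        ≡⟨ +-congˡ (correlation (+ 0)) (∑-cong {p′} (λ c → trans (correlation-scale {+ suc (toℕ c)} (suc≁0 c)) (sym (ℤ.*-identityʳ _)))) ⟨
      ∑ {p} (λ c → correlation (+ toℕ c))
        ≡⟨ total ⟩
      + 0 ∎

  ∑-χχ : ∀ a b → ∑ {p} (λ k → χ (a + + toℕ k) * χ (b + + toℕ k)) ≡ correlation (b - a)
  ∑-χχ a b = begin
    ∑ {p} (λ k → χ (a + + toℕ k) * χ (b + + toℕ k))
      ≡⟨ ∑-cong {p} (λ k → cong (λ z → χ (a + + toℕ k) * χ z) (lemma a b (+ toℕ k))) ⟩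
    ∑ {p} (λ k → χ (a + + toℕ k) * χ (b - a + (a + + toℕ k)))
      ≡⟨ ∑-reindex (λ z → χ z * χ (b - a + z))
           (λ d → cong₂ _*_ (χ-cong d) (χ-cong (∼-+ (∼-refl {b - a}) d)))
           (λ k → a + + toℕ k) (+-injective-∼ a) ⟩
    correlation (b - a) ∎
    where
    lemma : ∀ a b x → b + x ≡ b - a + (a + x)
    lemma = solve-∀

  S R : Matrix p
  S i j = χ (+ 1 + + toℕ i + + toℕ j)
  R i j = δ (opposite i) j

  opposite-sum : ∀ (i : Fin p) → + 1 + + toℕ i + + toℕ (opposite i) ≡ + p
  opposite-sum i = cong +_ (trans (cong (suc (toℕ i) ℕ.+_) (Fin.opposite-prop i)) (ℕ.m+[n∸m]≡n (Fin.toℕ<n i)))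

  δ-sym : ∀ {n} (i j : Fin n) → δ i j ≡ δ j i
  δ-sym i j = by-cases (i Fin.≟ j)
    where
    by-cases : Dec (i ≡ j) → δ i j ≡ δ j i
    by-cases (yes refl) = refl
    by-cases (no i≢j)   = trans (δ-≢ i≢j) (sym (δ-≢ (i≢j ∘ sym)))

  δ-opposite : ∀ {n} (i j : Fin n) → δ (opposite i) (opposite j) ≡ δ i j
  δ-opposite i j = by-cases (i Fin.≟ j)
    where
    by-cases : Dec (i ≡ j) → δ (opposite i) (opposite j) ≡ δ i j
    by-cases (yes refl) = trans (δ-refl (opposite i)) (sym (δ-refl i))
    by-cases (no i≢j)   = trans (δ-≢ (λ eq → i≢j (trans (sym (Fin.opposite-involutive i))
      (trans (cong opposite eq) (Fin.opposite-involutive j))))) (sym (δ-≢ i≢j))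

  S-sym : IsSymmetric p S
  S-sym i j = cong χ (lemma (+ toℕ i) (+ toℕ j))
    where
    lemma : ∀ x y → + 1 + x + y ≡ + 1 + y + x
    lemma = solve-∀

  R-sym : IsSymmetric p R
  R-sym i j = begin
    δ (opposite i) j                       ≡⟨ cong (δ (opposite i)) (Fin.opposite-involutive j) ⟨
    δ (opposite i) (opposite (opposite j)) ≡⟨ δ-opposite i (opposite j) ⟩
    δ i (opposite j)                       ≡⟨ δ-sym i (opposite j) ⟩
    δ (opposite j) i                       ∎

  gram-SS : ∀ i j → gram S S i j ≡ + p * δ i j - + 1
  gram-SS i j = trans (∑-χχ (+ 1 + + toℕ i) (+ 1 + + toℕ j)) (by-cases (i Fin.≟ j))
    where
    difference : ∀ x y → + 1 + y - (+ 1 + x) - + 0 ≡ y - x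
    difference = solve-∀
    by-cases : Dec (i ≡ j) → correlation (+ 1 + + toℕ j - (+ 1 + + toℕ i)) ≡ + p * δ i j - + 1
    by-cases (yes refl) = begin
      correlation (+ 1 + + toℕ i - (+ 1 + + toℕ i)) ≡⟨ cong correlation (ℤ.+-inverseʳ (+ 1 + + toℕ i)) ⟩
      correlation (+ 0)                             ≡⟨ correlation-zero ⟩
      + p′                                          ≡⟨ lemma (+ p′) ⟩
      (+ 1 + + p′) * + 1 - + 1                      ≡⟨ cong (λ d → + p * d - + 1) (δ-refl i) ⟨
      + p * δ i i - + 1                             ∎
      where
      lemma : ∀ z → z ≡ (+ 1 + z) * + 1 - + 1
      lemma = solve-∀
    by-cases (no i≢j) = begin
      correlation (+ 1 + + toℕ j - (+ 1 + + toℕ i))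
        ≡⟨ correlation-scale {+ 1 + + toℕ j - (+ 1 + + toℕ i)} (λ d → i≢j (sym (toℕ-injective-mod j i (∼-by (difference (+ toℕ i) (+ toℕ j)) d)))) ⟩
      correlation (+ 1)  ≡⟨ correlation-one ⟩
      - + 1              ≡⟨ cong (_- + 1) (ℤ.*-zeroʳ (+ p)) ⟨
      + p * + 0 - + 1    ≡⟨ cong (λ d → + p * d - + 1) (δ-≢ i≢j) ⟨
      + p * δ i j - + 1  ∎

  gram-SR : ∀ i j → gram S R i j ≡ - gram R S i j
  gram-SR i j = begin
    gram S R i j      ≡⟨ ∑-δ (S i) (opposite j) ⟩
    S i (opposite j)  ≡⟨ χ-cong {y = - y} (∼-trans {y = + p + + p - y} (∼-reflexive x≡) 2p-y∼-y) ⟩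
    χ (- y)           ≡⟨ χ-neg y ⟩
    - S j (opposite i) ≡⟨ cong -_ (∑-δ (S j) (opposite i)) ⟨
    - gram S R j i    ≡⟨ cong -_ (gram-swap S R j i) ⟩
    - gram R S i j    ∎
    where
    x y : ℤ
    x = + 1 + + toℕ i + + toℕ (opposite j)
    y = + 1 + + toℕ j + + toℕ (opposite i)
    lemma : ∀ i j i′ j′ → + 1 + i + j′ ≡ (+ 1 + i + i′) + (+ 1 + j + j′) - (+ 1 + j + i′)
    lemma = solve-∀
    x≡ : x ≡ + p + + p - y
    x≡ = trans (lemma (+ toℕ i) (+ toℕ j) (+ toℕ (opposite i)) (+ toℕ (opposite j)))
      (cong₂ (λ u v → u + v - y) (opposite-sum i) (opposite-sum j))
    2p-y∼-y : + p + + p - y ∼ - y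
    2p-y∼-y = subst (λ z → + p + + p - y ∼ z) (ℤ.+-identityˡ (- y)) (∼-+ (∼-+ p∼0 p∼0) (∼-refl { - y}))

  S-R-entries : ∀ i j → Letter (S i j) (R i j)
  S-R-entries i j = by-cases (opposite i Fin.≟ j)
    where
    lemma : ∀ i j i′ → (+ 1 + i + j) - (+ 1 + i + i′) ≡ j - i′
    lemma = solve-∀
    by-cases : Dec (opposite i ≡ j) → Letter (S i j) (R i j)
    by-cases (yes refl) = inj₁ (δ-refl (opposite i) , χ-zero (∼-trans (∼-reflexive (opposite-sum i)) p∼0))
    by-cases (no i′≢j)  = inj₂ (δ-≢ i′≢j , χ-nonzero λ d → i′≢j (sym (toℕ-injective-mod j (opposite i)
      (∼-by (lemma (+ toℕ i) (+ toℕ j) (+ toℕ (opposite i)))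
        (∼-trans d (∼-sym (∼-trans (∼-reflexive (opposite-sum i)) p∼0)))))))

  core : Core S R
  core = record
    { S-sym   = S-sym
    ; R-sym   = R-sym
    ; SS      = gram-SS
    ; RR      = λ i j → trans (∑-δ (R i) (opposite j)) (δ-opposite i j)
    ; SR      = gram-SR
    ; S-row   = λ i → ∑-χ-shift (+ 1 + + toℕ i)
    ; R-row   = λ i → trans (∑-cong (λ k → sym (ℤ.*-identityˡ (R i k)))) (∑-δ (λ _ → + 1) (opposite i))
    ; entries = S-R-entries
    }

square-mod-4 : ∀ p → (p ℕ.* p) % 4 ≡ 0 ⊎ (p ℕ.* p) % 4 ≡ 1
square-mod-4 p rewrite %-distribˡ-* p p 4 {{_}} with p % 4 | m%n<n p 4
... | 0 | _ = inj₁ refl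
... | 1 | _ = inj₂ refl
... | 2 | _ = inj₁ refl
... | 3 | _ = inj₂ refl
... | suc (suc (suc (suc _))) | ℕ.s≤s (ℕ.s≤s (ℕ.s≤s (ℕ.s≤s ())))

odd-power-mod-4 : ∀ p k → (p ℕ.^ k) % 4 ≡ 3 → p % 4 ≡ 3 × Odd k
odd-power-mod-4 p 1             eq = trans (cong (_% 4) (sym (ℕ.*-identityʳ p))) eq , one
odd-power-mod-4 p (suc (suc k)) eq = by-cases (square-mod-4 p)
  where
  reduce : ∀ {s} → (p ℕ.* p) % 4 ≡ s → (s ℕ.* ((p ℕ.^ k) % 4)) % 4 ≡ 3
  reduce {s} p²≡s = begin
    (s ℕ.* ((p ℕ.^ k) % 4)) % 4                ≡⟨ cong (λ s → (s ℕ.* ((p ℕ.^ k) % 4)) % 4) p²≡s ⟨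
    ((p ℕ.* p) % 4 ℕ.* ((p ℕ.^ k) % 4)) % 4    ≡⟨ %-distribˡ-* (p ℕ.* p) (p ℕ.^ k) 4 ⟨
    (p ℕ.* p ℕ.* p ℕ.^ k) % 4                  ≡⟨ cong (_% 4) (ℕ.*-assoc p p (p ℕ.^ k)) ⟩
    (p ℕ.^ suc (suc k)) % 4                    ≡⟨ eq ⟩
    3                                          ∎
  by-cases : (p ℕ.* p) % 4 ≡ 0 ⊎ (p ℕ.* p) % 4 ≡ 1 → p % 4 ≡ 3 × Odd (suc (suc k))
  by-cases (inj₁ p²≡0) = contradiction (reduce p²≡0) λ ()
  by-cases (inj₂ p²≡1) with odd-power-mod-4 p k (begin
    (p ℕ.^ k) % 4               ≡⟨ m%n%n≡m%n (p ℕ.^ k) 4 ⟨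
    (p ℕ.^ k) % 4 % 4           ≡⟨ cong (_% 4) (ℕ.*-identityˡ ((p ℕ.^ k) % 4)) ⟨
    (1 ℕ.* ((p ℕ.^ k) % 4)) % 4 ≡⟨ reduce p²≡1 ⟩
    3                           ∎)
  ... | p≡3 , odd = p≡3 , 2+ odd

paley-core : ∀ p → Prime p → p % 4 ≡ 3 → ∃[ S ] ∃[ R ] Core {p} S R
paley-core p p-prime p≡3 = subst (λ p → ∃[ S ] ∃[ R ] Core {p} S R) (sym p≡)
  (Paley.S l prime′ , Paley.R l prime′ , Paley.core l prime′)
  where
  l : ℕ
  l = p / 4
  lemma : ∀ l → 3 ℕ.+ l ℕ.* 4 ≡ suc (suc (l ℕ.+ l) ℕ.+ suc (l ℕ.+ l))
  lemma = ℕ-Solver.solve-∀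
  p≡ : p ≡ suc (suc (l ℕ.+ l) ℕ.+ suc (l ℕ.+ l))
  p≡ = trans (m≡m%n+[m/n]*n p 4) (trans (cong (ℕ._+ l ℕ.* 4) p≡3) (lemma l))
  prime′ : Prime (suc (suc (l ℕ.+ l) ℕ.+ suc (l ℕ.+ l)))
  prime′ = subst Prime p≡ p-prime

theorem2 : (q : ℕ) → IsPrimePower q → q % 8 ≡ 3 →
    ∃[ H ] (IsHadamard (q ℕ.* (1 ℕ.+ q)) H × IsSymmetric (q ℕ.* (1 ℕ.+ q)) H)
theorem2 _ (p , k , p-prime , _ , refl) q≡3
  with odd-power-mod-4 p k (trans (sym (m∣n⇒o%n%m≡o%m 4 8 (p ℕ.^ k) (ℕ.divides 2 refl))) (cong (_% 4) q≡3))
... | p≡3 , odd with paley-core p p-prime p≡3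
... | S , R , core = H , (H-pm1 , gram-HH) , H-sym
  where open Hadamard (Power.power core odd)
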